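{- Let $\alpha$ be a set with an involution $\tau:\alpha\to\alpha$. If $\tau\neq\mathrm{id}$, then the group $\mathcal N_c=\mathcal N_c(\alpha,\tau)$ of cobordism classes of nanowords over $\alpha$ is infinitely generated (i.e. not finitely generated).
   Context: **Nanowords.** $\alpha$ is a set with an involution $\tau:\alpha\to\alpha$ ($\tau^2=\mathrm{id}$; fixed points allowed). An $\alpha$-alphabet is a set $\mathcal A$ with a map $\mathcal A\to\alpha$, $A\mapsto|A|$. A nanoword of length $n$ over $\alpha$ is a pair $(\mathcal A,w)$ with $\mathcal A$ an $\alpha$-alphabet and $w:\{1,\dots,n\}\to\mathcal A$ a map (written as the sequence $w(1)\cdots w(n)$) taking every value in $\mathcal A$ exactly twice; there is a unique empty nanoword $\emptyset$. Nanowords $(\mathcal A,w),(\mathcal A',w')$ are isomorphic if $w'=fw$ for a bijection $f:\mathcal A\to\mathcal A'$ with $|f(A)|=|A|$. The opposite word of $w$ is $w^-=w(n)\cdots w(1)$. The product of two nanowords is their concatenation, after making the alphabets disjoint by an isomorphism. **Homotopy moves.** (1) $(\mathcal A,xAAy)\mapsto(\mathcal A-\{A\},xy)$; (2) $(\mathcal A,xAByBAz)\mapsto(\mathcal A-\{A,B\},xyz)$ if $|B|=\tau(|A|)$; (3) $(\mathcal A,xAByACzBCt)\mapsto(\mathcal A,xBAyCAzCBt)$ for distinct $A,B,C$ with $|A|=|B|=|C|$. **Surgery.** A nanophrase $\nabla=(\mathcal B,(v_1|\cdots|v_k))$ is a sequence of words in an $\alpha$-alphabet $\mathcal B$ such that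 every letter of $\mathcal B$ appears exactly twice in $v_1v_2\cdots v_k$. Put $\varepsilon_\nabla(B)=0$ if both occurrences of $B$ are in the same $v_r$, and $\varepsilon_\nabla(B)=1$ otherwise. $\nabla$ is even if all $v_r$ have even length; it is symmetric if there is a bijection $\iota:\mathcal B\to\mathcal B$ with $\iota v_r=v_r^-$ for all $r$ and $|\iota(B)|=\tau^{\varepsilon_\nabla(B)}(|B|)$ for all $B$. $\nabla$ is a factor of a nanoword $(\mathcal A,w)$ if $\mathcal B\subset\mathcal A$ (with restricted projection to $\alpha$) and $w=x_1v_1x_2v_2\cdots x_kv_kx_{k+1}$ with $x_i$ words in $\mathcal A-\mathcal B$. A surgery replaces $(\mathcal A,w)$ by $(\mathcal A-\mathcal B,x_1x_2\cdots x_{k+1})$, where $\nabla$ is an even symmetric factor. **Cobordism.** Two nanowords are cobordant if they are related by a finite sequence of isomorphisms, homotopy moves, surgeries and inverse moves. The cobordism classes form a group $\mathcal N_c=\mathcal N_c(\alpha,\tau)$ under concatenation, with unit the class of $\emptyset$ and inverse of $w$ given by $w^-$. -}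

module Defs where

open import Algebra.Bundles using (Group)
open import Data.Bool.Base using (if_then_else_)
open import Data.Empty using (⊥)
open import Data.Fin.Base using (Fin)
open import Data.Fin.Patterns using (0F; 1F)
open import Data.Fin.Properties using (_≟_)
import Data.Irrelevant as Irrelevant
open import Data.List.Base using (List; []; _∷_; _++_; map; reverse; concat; length)
open import Data.List.Membership.Propositional using (_∈_)
import Data.List.Membership.Setoid as SetoidMembership
open import Data.List.Properties
  using (++-assoc; ++-identityʳ; map-++; map-∘; map-id; map-cong;
         reverse-++; reverse-map; reverse-involutive; length-++; length-map; length-reverse)
open import Data.List.Relation.Binary.BagAndSetEquality using (↭⇒∼bag)
open import Data.List.Relation.Binary.Permutation.Propositional.Properties using (↭-reverse)
open import Data.List.Relation.Unary.Any.Properties using (Any-cong; map↔; ++↔; ⊥↔Any⊥)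
open import Data.Nat.Base using (ℕ; suc; _+_; _*_)
open import Data.Nat.Divisibility using (_∣_; divides)
open import Data.Nat.Properties using (*-comm; +-identityʳ)
open import Data.Product.Base using (∃; _,_)
open import Data.Refinement using (Refinement; _,_; value)
open import Data.Sum.Base as Sum using (_⊎_; inj₁; inj₂; [_,_]; swap)
open import Data.Sum.Algebra using (⊎-assoc)
open import Data.Sum.Function.Propositional using (_⊎-cong_)
open import Data.Sum.Properties using (swap-↔; inj₁-injective; inj₂-injective)
open import Data.Vec.Base as Vec using (Vec; []; _∷_)
open import Data.Vec.Relation.Unary.All using (All; []; _∷_)
open import Data.Vec.Relation.Unary.Any as VecAny using ()
open import Data.Vec.Relation.Unary.Any.Properties using (singleton↔)
open import Function.Base using (_∘_; id)
import Function.Endo.Propositional as Endo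
open import Function.Bundles using (_↔_; _↣_; Inverse; Injection; mk↔ₛ′; mk↣)
open import Function.Properties.Inverse using (↔-refl; ↔-sym; ↔-trans; ↔⇒↣)
open import Level using (Level; 0ℓ; _⊔_) renaming (suc to lsuc)
open import Relation.Binary.Construct.Closure.Equivalence as Eq using (EqClosure)
open import Relation.Binary.Core using (Rel)
open import Relation.Binary.Structures using (IsEquivalence)
open import Relation.Binary.PropositionalEquality
  using (_≡_; _≢_; refl; sym; trans; cong; cong₂; subst; module ≡-Reasoning)
open import Relation.Binary.PropositionalEquality.WithK using (≡-irrelevant)
open import Relation.Nullary using (¬_; does; contradiction)
open import Relation.Nullary.Negation using (contradiction-irr)
open import Relation.Unary using (Pred; ∁; ｛_｝; _∪_)

private
  variable
    ℓ₁ ℓ₂ : Level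
    k : ℕ
    X Y : Set

module _ (G : Group ℓ₁ ℓ₂) where
  open Group G using (Carrier; _≈_; _∙_; ε; _⁻¹; setoid)
  open SetoidMembership setoid using () renaming (_∈_ to _∈ᴳ_)

  data Generated (gs : List Carrier) : Carrier → Set (ℓ₁ ⊔ ℓ₂) where
    generator : ∀ {x} → x ∈ᴳ gs → Generated gs x
    unit      : Generated gs ε
    product   : ∀ {x y} → Generated gs x → Generated gs y → Generated gs (x ∙ y)
    inverse   : ∀ {x} → Generated gs x → Generated gs (x ⁻¹)
    respects  : ∀ {x y} → x ≈ y → Generated gs x → Generated gs y

  FinitelyGenerated : Set (ℓ₁ ⊔ ℓ₂)
  FinitelyGenerated = ∃ λ gs → ∀ x → Generated gs x

-- Under axiom K the proofs of A ∈ w are precisely the positions at which A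
-- occurs in w.
EachTwice : List X → Set
EachTwice w = ∀ A → (A ∈ w) ↔ Fin 2

-- weave (x₁ ∷ … ∷ xₖ₊₁ ∷ []) (v₁ ∷ … ∷ vₖ ∷ []) is the word x₁v₁x₂v₂⋯xₖvₖxₖ₊₁.
weave : Vec (List X) (suc k) → Vec (List X) k → List X
weave (x ∷ [])          []       = x
weave (x ∷ xs@(_ ∷ _)) (v ∷ vs) = x ++ v ++ weave xs vs

⊥-⊎ : (⊥ ⊎ X) ↔ X
⊥-⊎ = mk↔ₛ′ (λ { (inj₁ ()) ; (inj₂ x) → x }) inj₂ (λ _ → refl) (λ { (inj₁ ()) ; (inj₂ _) → refl })

⊎-⊥ : (X ⊎ ⊥) ↔ X
⊎-⊥ = mk↔ₛ′ (λ { (inj₁ x) → x ; (inj₂ ()) }) inj₁ (λ _ → refl) (λ { (inj₁ _) → refl ; (inj₂ ()) })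

≡-↔ : {x x′ : X} {y y′ : Y} → (x ≡ x′ → y ≡ y′) → (y ≡ y′ → x ≡ x′) → (x ≡ x′) ↔ (y ≡ y′)
≡-↔ f g = mk↔ₛ′ f g (λ _ → ≡-irrelevant _ _) (λ _ → ≡-irrelevant _ _)

∈-map-injective : (w : List X) {f : X → Y} → (∀ {x x′} → f x ≡ f x′ → x ≡ x′) →
                  ∀ {A} → (f A ∈ map f w) ↔ (A ∈ w)
∈-map-injective w {f} inj =
  ↔-trans (↔-sym map↔) (Any-cong (λ _ → ≡-↔ inj (cong f)) ↔-refl)

∈-map-∉ : (w : List X) {f : X → Y} {B : Y} → (∀ x → B ≢ f x) → (B ∈ map f w) ↔ ⊥
∈-map-∉ w B≢f =
  ↔-trans (↔-sym map↔)
  (↔-trans (Any-cong (λ x → mk↔ₛ′ (B≢f x) (λ ()) (λ ()) (λ eq → contradiction eq (B≢f x))) ↔-refl)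
           (↔-sym (⊥↔Any⊥ {xs = w})))

map-eachTwice : (f : X ↔ Y) {w : List X} → EachTwice w → EachTwice (map (Inverse.to f) w)
map-eachTwice f {w} t B = subst (λ B → (B ∈ map to w) ↔ Fin 2) (strictlyInverseˡ B)
  (↔-trans (∈-map-injective w (Injection.injective (↔⇒↣ f))) (t (from B)))
  where open Inverse f

++-eachTwice : {w : List X} {v : List Y} → EachTwice w → EachTwice v →
               EachTwice (map inj₁ w ++ map inj₂ v)
++-eachTwice {w = w} {v} t s (inj₁ A) =
  ↔-trans (↔-sym ++↔)
  (↔-trans (∈-map-injective w inj₁-injective ⊎-cong ∈-map-∉ v (λ _ ())) (↔-trans ⊎-⊥ (t A)))
++-eachTwice {w = w} {v} t s (inj₂ B) =
  ↔-trans (↔-sym ++↔)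
  (↔-trans (∈-map-∉ w (λ _ ()) ⊎-cong ∈-map-injective v inj₂-injective) (↔-trans ⊥-⊎ (s B)))

reverse-eachTwice : {w : List X} → EachTwice w → EachTwice (reverse w)
reverse-eachTwice {w = w} t A = ↔-trans (↭⇒∼bag (↭-reverse w)) (t A)

map-swap : (w : List X) (v : List Y) →
           map swap (map inj₁ w ++ map inj₂ v) ≡ map inj₂ w ++ map inj₁ v
map-swap w v = trans (map-++ swap (map inj₁ w) _) (cong₂ _++_ (sym (map-∘ w)) (sym (map-∘ v)))

prepend : List X → Vec (List X) (suc k) → Vec (List X) (suc k)
prepend u (x ∷ xs) = (u ++ x) ∷ xs

append : List X → Vec (List X) (suc k) → Vec (List X) (suc k)
append v (x ∷ [])         = (x ++ v) ∷ []
append v (x ∷ xs@(_ ∷ _)) = x ∷ append v xs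

weave-prepend : (g : X → Y) (u : List X) (xs : Vec (List X) (suc k)) (vs : Vec (List Y) k) →
                weave (Vec.map (map g) (prepend u xs)) vs ≡
                map g u ++ weave (Vec.map (map g) xs) vs
weave-prepend g u (x ∷ [])    []       = map-++ g u x
weave-prepend g u (x ∷ _ ∷ _) (v ∷ vs) =
  trans (cong (_++ _) (map-++ g u x)) (++-assoc (map g u) _ _)

weave-append : (g : X → Y) (u : List X) (xs : Vec (List X) (suc k)) (vs : Vec (List Y) k) →
               weave (Vec.map (map g) (append u xs)) vs ≡
               weave (Vec.map (map g) xs) vs ++ map g u
weave-append g u (x ∷ [])             []       = map-++ g x u
weave-append g u (x ∷ y ∷ ys) (v ∷ vs) = trans (step (y ∷ ys))
  (trans (cong (λ w → map g x ++ v ++ w) (weave-append g u (y ∷ ys) vs))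
         (sym (trans (++-assoc (map g x) _ _) (cong (map g x ++_) (++-assoc v _ _)))))
  where
  step : ∀ ys → weave (Vec.map (map g) (x ∷ append u ys)) (v ∷ vs) ≡
                map g x ++ v ++ weave (Vec.map (map g) (append u ys)) vs
  step (_ ∷ [])    = refl
  step (_ ∷ _ ∷ _) = refl

weave-map : ∀ {A B C D E : Set} (h : D → E) (l : A → D) (i : B → E) {g : A → B} (j : C → B) →
            (∀ a → h (l a) ≡ i (g a)) →
            (xs : Vec (List A) (suc k)) (vs : Vec (List C) k) →
            weave (Vec.map (map h) (Vec.map (map l) xs)) (Vec.map (map (i ∘ j)) vs) ≡
            map i (weave (Vec.map (map g) xs) (Vec.map (map j) vs))
weave-map h l i {g} j eq (x ∷ [])     []       =
  trans (sym (map-∘ x)) (trans (map-cong eq x) (map-∘ x))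
weave-map h l i {g} j eq (x ∷ y ∷ ys) (v ∷ vs) = trans
  (cong₂ _++_ (trans (sym (map-∘ x)) (trans (map-cong eq x) (map-∘ x)))
              (cong₂ _++_ (map-∘ v) (weave-map h l i j eq (y ∷ ys) vs)))
  (sym (trans (map-++ i (map g x) _) (cong (map i (map g x) ++_) (map-++ i (map j v) _))))

concat-prepend : (u : List X) (xs : Vec (List X) (suc k)) →
                 concat (Vec.toList (prepend u xs)) ≡ u ++ concat (Vec.toList xs)
concat-prepend u (x ∷ xs) = ++-assoc u x _

concat-append : (u : List X) (xs : Vec (List X) (suc k)) →
                concat (Vec.toList (append u xs)) ≡ concat (Vec.toList xs) ++ u
concat-append u (x ∷ [])     = trans (++-identityʳ _) (cong (_++ u) (sym (++-identityʳ x)))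
concat-append u (x ∷ y ∷ ys) =
  trans (cong (x ++_) (concat-append u (y ∷ ys))) (sym (++-assoc x _ u))

concat-map-map : (f : X → Y) (xs : Vec (List X) k) →
                 concat (Vec.toList (Vec.map (map f) xs)) ≡ map f (concat (Vec.toList xs))
concat-map-map f []       = refl
concat-map-map f (x ∷ xs) = trans (cong (map f x ++_) (concat-map-map f xs)) (sym (map-++ f x _))

module Nanowords {a} {α : Set a} (τ : α → α) where

  open Endo α using (_^_)

  record Alphabet : Set (lsuc 0ℓ ⊔ a) where
    field
      Letter : Set
      proj   : Letter → α

  open Alphabet

  infix 6 _∖_

  _∖_ : (𝒜 : Alphabet) → Pred (Letter 𝒜) 0ℓ → Alphabet
  𝒜 ∖ P = record
    { Letter = Refinement (Letter 𝒜) (∁ P)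
    ; proj   = proj 𝒜 ∘ value
    }

  _⊎ᴬ_ : Alphabet → Alphabet → Alphabet
  𝒜 ⊎ᴬ ℬ = record
    { Letter = Letter 𝒜 ⊎ Letter ℬ
    ; proj   = [ proj 𝒜 , proj ℬ ]
    }

  emptyᴬ : Alphabet
  emptyᴬ = record { Letter = ⊥ ; proj = λ () }

  record Nanophrase : Set (lsuc 0ℓ ⊔ a) where
    field
      alphabet : Alphabet
      {size}   : ℕ
      words    : Vec (List (Letter alphabet)) size
      twice    : ∀ B → VecAny.Any (B ∈_) words ↔ Fin 2

    component : Letter alphabet → Fin 2 → Fin size
    component B i = VecAny.index (Inverse.from (twice B) i)

    ε : Letter alphabet → ℕ
    ε B = if does (component B 0F ≟ component B 1F) then 0 else 1

    Even : Set
    Even = All (λ v → 2 ∣ length v) words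

    record Symmetric : Set a where
      field
        ι        : Letter alphabet ↔ Letter alphabet
        reverses : All (λ v → map (Inverse.to ι) v ≡ reverse v) words
        label    : ∀ B → proj alphabet (Inverse.to ι B) ≡ (τ ^ ε B) (proj alphabet B)

  infix 4 _⊆_

  -- An inclusion of a sub-alphabet, given as an injection compatible with the
  -- projections to α.
  record _⊆_ (ℬ 𝒜 : Alphabet) : Set a where
    field
      injection : Letter ℬ ↣ Letter 𝒜
      label     : ∀ B → proj 𝒜 (Injection.to injection B) ≡ proj ℬ B

    inclusion : Letter ℬ → Letter 𝒜
    inclusion = Injection.to injection

    Image : Pred (Letter 𝒜) 0ℓ
    Image A = ∃ λ B → inclusion B ≡ A

  open _⊆_ using (inclusion; Image)

  record Nanoword : Set (lsuc 0ℓ ⊔ a) where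
    constructor nanoword
    field
      alphabet : Alphabet
      word     : List (Letter alphabet)
      twice    : EachTwice word

  open Nanoword

  infix 4 _≅_ _↝_

  record _≅_ (N M : Nanoword) : Set a where
    constructor isomorphism
    field
      bijection : Letter (alphabet N) ↔ Letter (alphabet M)
      label     : ∀ A → proj (alphabet M) (Inverse.to bijection A) ≡ proj (alphabet N) A
      image     : map (Inverse.to bijection) (word N) ≡ word M

  -- The letters surviving a deletion are refinements of the old ones, so the
  -- remaining words live over the smaller alphabet and `map value` regards
  -- them as words over the larger one.  Each target is again a nanoword
  -- whenever the source is, so q imposes no condition.
  data _↝_ : Rel Nanoword (lsuc 0ℓ ⊔ a) where

    iso : ∀ {N M} → N ≅ M → N ↝ M

    move₁ : ∀ {𝒜} A (x y : List (Letter (𝒜 ∖ ｛ A ｝))) {p q} →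
      nanoword 𝒜 (map value x ++ A ∷ A ∷ map value y) p
        ↝ nanoword (𝒜 ∖ ｛ A ｝) (x ++ y) q

    move₂ : ∀ {𝒜} A B (x y z : List (Letter (𝒜 ∖ (｛ A ｝ ∪ ｛ B ｝)))) {p q} →
      proj 𝒜 B ≡ τ (proj 𝒜 A) →
      nanoword 𝒜 (map value x ++ A ∷ B ∷ map value y ++ B ∷ A ∷ map value z) p
        ↝ nanoword (𝒜 ∖ (｛ A ｝ ∪ ｛ B ｝)) (x ++ y ++ z) q

    move₃ : ∀ {𝒜} A B C (x y z t : List (Letter 𝒜)) {p q} →
      A ≢ B → A ≢ C → B ≢ C →
      proj 𝒜 A ≡ proj 𝒜 B → proj 𝒜 B ≡ proj 𝒜 C →
      nanoword 𝒜 (x ++ A ∷ B ∷ y ++ A ∷ C ∷ z ++ B ∷ C ∷ t) p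
        ↝ nanoword 𝒜 (x ++ B ∷ A ∷ y ++ C ∷ A ∷ z ++ C ∷ B ∷ t) q

    surgery : ∀ {𝒜} (∇ : Nanophrase) →
      Nanophrase.Even ∇ → Nanophrase.Symmetric ∇ →
      (ℬ⊆𝒜 : Nanophrase.alphabet ∇ ⊆ 𝒜)
      (xs : Vec (List (Letter (𝒜 ∖ Image ℬ⊆𝒜))) (suc (Nanophrase.size ∇))) {p : _} {q : _} →
      nanoword 𝒜
        (weave (Vec.map (map value) xs)
               (Vec.map (map (inclusion ℬ⊆𝒜)) (Nanophrase.words ∇))) p
        ↝ nanoword (𝒜 ∖ Image ℬ⊆𝒜) (concat (Vec.toList xs)) q

  infix 4 _~_

  -- Cobordism.
  _~_ : Rel Nanoword (lsuc 0ℓ ⊔ a)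
  _~_ = EqClosure _↝_

  ~-isEquivalence : IsEquivalence _~_
  ~-isEquivalence = Eq.isEquivalence _↝_

  ∅ : Nanoword
  ∅ = nanoword emptyᴬ [] λ ()

  infixl 7 _∙_
  infix  8 _⁻

  _∙_ : Nanoword → Nanoword → Nanoword
  N ∙ M = nanoword (alphabet N ⊎ᴬ alphabet M)
                   (map inj₁ (word N) ++ map inj₂ (word M))
                   (++-eachTwice (twice N) (twice M))

  _⁻ : Nanoword → Nanoword
  N ⁻ = nanoword (alphabet N) (reverse (word N)) (reverse-eachTwice (twice N))

  private
    open IsEquivalence ~-isEquivalence
      using () renaming (refl to ~-refl; sym to ~-sym; trans to ~-trans)

    move : ∀ {N M} → N ↝ M → N ~ M
    move = Eq.return

    reword : ∀ {𝒜 w w′ p q} → w ≡ w′ → nanoword 𝒜 w p ~ nanoword 𝒜 w′ q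
    reword eq = move (iso (isomorphism ↔-refl (λ _ → refl) (trans (map-id _) eq)))

    -- The nanoword obtained by inserting the word of N between two words which
    -- together use every letter of ℰ twice; both N ∙ M and M ∙ N are of this form.
    module Context (ℰ : Alphabet) (u v : List (Letter ℰ)) (u++v-twice : EachTwice (u ++ v)) where

      insert : List X → List (X ⊎ Letter ℰ)
      insert w = map inj₂ u ++ map inj₁ w ++ map inj₂ v

      insert-eachTwice : {w : List X} → EachTwice w → EachTwice (insert w)
      insert-eachTwice {w = w} t (inj₁ A) =
        ↔-trans (↔-sym ++↔)
        (↔-trans (∈-map-∉ u (λ _ ()) ⊎-cong
                   ↔-trans (↔-sym ++↔)
                     (↔-trans (∈-map-injective w inj₁-injective ⊎-cong ∈-map-∉ v (λ _ ()))
                              ⊎-⊥))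
        (↔-trans ⊥-⊎ (t A)))
      insert-eachTwice {w = w} t (inj₂ E) =
        ↔-trans (↔-sym ++↔)
        (↔-trans (∈-map-injective u inj₂-injective ⊎-cong
                   ↔-trans (↔-sym ++↔)
                     (↔-trans (∈-map-∉ w (λ _ ()) ⊎-cong ∈-map-injective v inj₂-injective)
                              ⊥-⊎))
        (↔-trans ++↔ (u++v-twice E)))

      context : Nanoword → Nanoword
      context N = nanoword (alphabet N ⊎ᴬ ℰ) (insert (word N)) (insert-eachTwice (twice N))

      map-insert : (f : X → Y) (w : List X) →
                   map [ inj₁ ∘ f , inj₂ ] (insert w) ≡ insert (map f w)
      map-insert f w = begin
        map g (insert w)
          ≡⟨ map-++ g (map inj₂ u) _ ⟩
        map g (map inj₂ u) ++ map g (map inj₁ w ++ map inj₂ v)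
          ≡⟨ cong₂ _++_ (sym (map-∘ u)) (map-++ g (map inj₁ w) _) ⟩
        map inj₂ u ++ map g (map inj₁ w) ++ map g (map inj₂ v)
          ≡⟨ cong (map inj₂ u ++_)
               (cong₂ _++_ (trans (sym (map-∘ w)) (map-∘ w)) (sym (map-∘ v))) ⟩
        insert (map f w) ∎
        where
        open ≡-Reasoning
        g = [ inj₁ ∘ f , inj₂ ]

      module Deletion {𝒜} (P : Pred (Letter 𝒜) 0ℓ) (P′ : Pred (Letter (𝒜 ⊎ᴬ ℰ)) 0ℓ)
                      (P⇒P′ : ∀ {A} → P A → P′ (inj₁ A)) (P′⇒P : ∀ {A} → P′ (inj₁ A) → P A)
                      (¬P′ : ∀ {E} → ¬ P′ (inj₂ E)) where

        left : Letter (𝒜 ∖ P) → Letter (𝒜 ⊎ᴬ ℰ ∖ P′)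
        left (A , Irrelevant.[ ¬p ]) = inj₁ A , Irrelevant.[ ¬p ∘ P′⇒P ]

        right : Letter ℰ → Letter (𝒜 ⊎ᴬ ℰ ∖ P′)
        right E = inj₂ E , Irrelevant.[ ¬P′ ]

        θ : Letter ((𝒜 ∖ P) ⊎ᴬ ℰ) ↔ Letter (𝒜 ⊎ᴬ ℰ ∖ P′)
        θ = mk↔ₛ′ [ left , right ] from
                  (λ { (inj₁ _ , _) → refl ; (inj₂ _ , _) → refl })
                  (λ { (inj₁ _) → refl ; (inj₂ _) → refl })
          where
          from : Letter (𝒜 ⊎ᴬ ℰ ∖ P′) → Letter ((𝒜 ∖ P) ⊎ᴬ ℰ)
          from (inj₁ A , Irrelevant.[ ¬p ]) = inj₁ (A , Irrelevant.[ ¬p ∘ P⇒P′ ])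
          from (inj₂ E , _)                 = inj₂ E

        surround : Vec (List (Letter (𝒜 ∖ P))) (suc k) →
                   Vec (List (Letter (𝒜 ⊎ᴬ ℰ ∖ P′))) (suc k)
        surround xs = prepend (map right u) (append (map right v) (Vec.map (map left) xs))

        source : (j : X → Letter 𝒜) (xs : Vec (List (Letter (𝒜 ∖ P))) (suc k)) (vs : Vec (List X) k) →
                 insert (weave (Vec.map (map value) xs) (Vec.map (map j) vs)) ≡
                 weave (Vec.map (map value) (surround xs)) (Vec.map (map (inj₁ ∘ j)) vs)
        source j xs vs = sym (begin
          weave (Vec.map (map value) (surround xs)) ws
            ≡⟨ weave-prepend value (map right u) (append (map right v) (Vec.map (map left) xs)) ws ⟩
          map value (map right u) ++
            weave (Vec.map (map value) (append (map right v) (Vec.map (map left) xs))) ws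
            ≡⟨ cong₂ _++_ (sym (map-∘ u)) (weave-append value (map right v) (Vec.map (map left) xs) ws) ⟩
          map inj₂ u ++ weave (Vec.map (map value) (Vec.map (map left) xs)) ws ++
            map value (map right v)
            ≡⟨ cong (map inj₂ u ++_) (cong₂ _++_ (weave-map value left inj₁ j (λ _ → refl) xs vs)
                                                 (sym (map-∘ v))) ⟩
          insert (weave (Vec.map (map value) xs) (Vec.map (map j) vs)) ∎)
          where
          open ≡-Reasoning
          ws = Vec.map (map (inj₁ ∘ j)) vs

        target : (xs : Vec (List (Letter (𝒜 ∖ P))) (suc k)) →
                 map (Inverse.to θ) (insert (concat (Vec.toList xs))) ≡
                 concat (Vec.toList (surround xs))
        target xs = sym (begin
          concat (Vec.toList (surround xs))
            ≡⟨ concat-prepend (map right u) (append (map right v) (Vec.map (map left) xs)) ⟩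
          map right u ++ concat (Vec.toList (append (map right v) (Vec.map (map left) xs)))
            ≡⟨ cong (map right u ++_) (concat-append (map right v) (Vec.map (map left) xs)) ⟩
          map right u ++ concat (Vec.toList (Vec.map (map left) xs)) ++ map right v
            ≡⟨ cong (λ w → map right u ++ w ++ map right v) (concat-map-map left xs) ⟩
          map right u ++ map left c ++ map right v
            ≡⟨ cong₂ _++_ (map-∘ u) (cong₂ _++_ (map-∘ c) (map-∘ v)) ⟩
          map t (map inj₂ u) ++ map t (map inj₁ c) ++ map t (map inj₂ v)
            ≡⟨ cong (map t (map inj₂ u) ++_) (map-++ t (map inj₁ c) _) ⟨
          map t (map inj₂ u) ++ map t (map inj₁ c ++ map inj₂ v)
            ≡⟨ map-++ t (map inj₂ u) _ ⟨
          map t (insert c) ∎)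
          where
          open ≡-Reasoning
          t = Inverse.to θ
          c = concat (Vec.toList xs)

        deletion : ∀ {w w′ W W′ p q} {xs : Vec (List (Letter (𝒜 ∖ P))) (suc k)} →
                   insert w ≡ W → w′ ≡ concat (Vec.toList xs) →
                   W′ ≡ concat (Vec.toList (surround xs)) →
                   (∀ {r s} → nanoword (𝒜 ⊎ᴬ ℰ) W r ↝ nanoword (𝒜 ⊎ᴬ ℰ ∖ P′) W′ s) →
                   nanoword (𝒜 ⊎ᴬ ℰ) (insert w) p ~ nanoword ((𝒜 ∖ P) ⊎ᴬ ℰ) (insert w′) q
        deletion {p = p} {q = q} {xs = xs} refl refl refl step =
          ~-trans (move (step {p} {subst EachTwice (target xs) (map-eachTwice θ q)}))
                  (~-sym (move (iso (isomorphism θ (λ { (inj₁ _) → refl ; (inj₂ _) → refl })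
                                                 (target xs)))))

      context-cong-↝ : ∀ {N M} → N ↝ M → context N ~ context M
      context-cong-↝ {N} (iso (isomorphism f label image)) =
        move (iso (isomorphism (f ⊎-cong ↔-refl)
          (λ { (inj₁ A) → label A ; (inj₂ _) → refl })
          (trans (map-cong (λ { (inj₁ _) → refl ; (inj₂ _) → refl }) (insert (word N)))
                 (trans (map-insert (Inverse.to f) (word N)) (cong insert image)))))
      context-cong-↝ (move₁ {𝒜} A x y) =
        deletion {xs = x ∷ y ∷ []} (source id (x ∷ y ∷ []) ((A ∷ A ∷ []) ∷ []))
          (cong (x ++_) (sym (++-identityʳ y)))
          (cong ((map right u ++ map left x) ++_) (sym (++-identityʳ _)))
          (move₁ (inj₁ A) (map right u ++ map left x) (map left y ++ map right v))
        where open Deletion {𝒜} ｛ A ｝ ｛ inj₁ A ｝ (cong inj₁) inj₁-injective (λ ())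
      context-cong-↝ (move₂ {𝒜} A B x y z eq) =
        deletion {xs = x ∷ y ∷ z ∷ []} (source id (x ∷ y ∷ z ∷ []) ((A ∷ B ∷ []) ∷ (B ∷ A ∷ []) ∷ []))
          (cong (λ w → x ++ y ++ w) (sym (++-identityʳ z)))
          (cong (λ w → (map right u ++ map left x) ++ map left y ++ w) (sym (++-identityʳ _)))
          (move₂ (inj₁ A) (inj₁ B)
             (map right u ++ map left x) (map left y) (map left z ++ map right v) eq)
        where
        open Deletion {𝒜} (｛ A ｝ ∪ ｛ B ｝) (｛ inj₁ A ｝ ∪ ｛ inj₁ B ｝)
          (Sum.map (cong inj₁) (cong inj₁)) (Sum.map inj₁-injective inj₁-injective)
          [ (λ ()) , (λ ()) ]
      context-cong-↝ (move₃ {𝒜} A B C x y z t {p} {q} A≢B A≢C B≢C ∣A∣≡∣B∣ ∣B∣≡∣C∣) =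
        ~-trans (reword {q = subst EachTwice (regroup A B A C B C) (insert-eachTwice p)}
                        (regroup A B A C B C))
        (~-trans (move (move₃ (inj₁ A) (inj₁ B) (inj₁ C) _ _ _ _
                   (A≢B ∘ inj₁-injective) (A≢C ∘ inj₁-injective) (B≢C ∘ inj₁-injective)
                   ∣A∣≡∣B∣ ∣B∣≡∣C∣))
                 (reword {p = subst EachTwice (regroup B A C A C B) (insert-eachTwice q)}
                         (sym (regroup B A C A C B))))
        where
        regroup : ∀ D E F G H I →
          insert (x ++ D ∷ E ∷ y ++ F ∷ G ∷ z ++ H ∷ I ∷ t) ≡
          (map inj₂ u ++ map inj₁ x) ++ inj₁ D ∷ inj₁ E ∷ map inj₁ y ++
            inj₁ F ∷ inj₁ G ∷ map inj₁ z ++ inj₁ H ∷ inj₁ I ∷ map inj₁ t ++ map inj₂ v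
        regroup D E F G H I = trans (cong (map inj₂ u ++_)
          (push x (cong (λ w → _ ∷ _ ∷ w) (push y (cong (λ w → _ ∷ _ ∷ w) (push z refl))))))
          (sym (++-assoc (map inj₂ u) _ _))
          where
          push : ∀ x {w w′} → map inj₁ w ++ map inj₂ v ≡ w′ →
                 map inj₁ (x ++ w) ++ map inj₂ v ≡ map inj₁ x ++ w′
          push x eq = trans (cong (_++ map inj₂ v) (map-++ inj₁ x _))
                            (trans (++-assoc (map inj₁ x) _ _) (cong (map inj₁ x ++_) eq))
      context-cong-↝ (surgery {𝒜} ∇ even symmetric ℬ⊆𝒜 xs) =
        deletion {xs = xs} (source (inclusion ℬ⊆𝒜) xs (Nanophrase.words ∇)) refl refl
          (surgery ∇ even symmetric ℬ⊆𝒜⊎ℰ (surround xs))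
        where
        ℬ⊆𝒜⊎ℰ : Nanophrase.alphabet ∇ ⊆ (𝒜 ⊎ᴬ ℰ)
        ℬ⊆𝒜⊎ℰ = record
          { injection = mk↣ (Injection.injective (_⊆_.injection ℬ⊆𝒜) ∘ inj₁-injective)
          ; label     = _⊆_.label ℬ⊆𝒜
          }
        open Deletion {𝒜} (Image ℬ⊆𝒜) (Image ℬ⊆𝒜⊎ℰ)
          (λ (B , eq) → B , cong inj₁ eq) (λ (B , eq) → B , inj₁-injective eq) (λ ())

      context-cong : ∀ {N M} → N ~ M → context N ~ context M
      context-cong = Eq.gfold ~-isEquivalence context context-cong-↝

    ∙-congʳ : ∀ {N N′} M → N ~ N′ → N ∙ M ~ N′ ∙ M
    ∙-congʳ M N~N′ = ~-trans (reword refl) (~-trans (context-cong N~N′) (reword refl))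
      where open Context (alphabet M) [] (word M) (twice M)

    ∙-congˡ : ∀ M {N N′} → N ~ N′ → M ∙ N ~ M ∙ N′
    ∙-congˡ M {N} {N′} N~N′ =
      ~-trans (flip N) (~-trans (context-cong N~N′) (~-sym (flip N′)))
      where
      open Context (alphabet M) (word M) [] (subst EachTwice (sym (++-identityʳ _)) (twice M))
      flip : ∀ N → M ∙ N ~ context N
      flip N = move (iso (isomorphism swap-↔ (λ { (inj₁ _) → refl ; (inj₂ _) → refl })
        (trans (map-swap (word M) (word N)) (cong (map inj₂ (word M) ++_) (sym (++-identityʳ _))))))

    ∙-cong : ∀ {N N′ M M′} → N ~ N′ → M ~ M′ → N ∙ M ~ N′ ∙ M′
    ∙-cong {N′ = N′} {M} N~N′ M~M′ = ~-trans (∙-congʳ M N~N′) (∙-congˡ N′ M~M′)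

    ∙-assoc : ∀ N M L → (N ∙ M) ∙ L ~ N ∙ (M ∙ L)
    ∙-assoc N M L = move (iso (isomorphism (⊎-assoc _ _ _ _)
      (λ { (inj₁ (inj₁ _)) → refl ; (inj₁ (inj₂ _)) → refl ; (inj₂ _) → refl })
      (begin
        map f (map inj₁ (map inj₁ w₁ ++ map inj₂ w₂) ++ map inj₂ w₃)
          ≡⟨ map-++ f (map inj₁ (map inj₁ w₁ ++ map inj₂ w₂)) _ ⟩
        map f (map inj₁ (map inj₁ w₁ ++ map inj₂ w₂)) ++ map f (map inj₂ w₃)
          ≡⟨ cong₂ _++_ (trans (sym (map-∘ _)) (map-++ (f ∘ inj₁) (map inj₁ w₁) _))
                        (sym (map-∘ w₃)) ⟩
        (map (f ∘ inj₁) (map inj₁ w₁) ++ map (f ∘ inj₁) (map inj₂ w₂)) ++ map (inj₂ ∘ inj₂) w₃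
          ≡⟨ cong (_++ map (inj₂ ∘ inj₂) w₃) (cong₂ _++_ (map-∘ w₁) (map-∘ w₂)) ⟨
        (map inj₁ w₁ ++ map (inj₂ ∘ inj₁) w₂) ++ map (inj₂ ∘ inj₂) w₃
          ≡⟨ ++-assoc (map inj₁ w₁) _ _ ⟩
        map inj₁ w₁ ++ map (inj₂ ∘ inj₁) w₂ ++ map (inj₂ ∘ inj₂) w₃
          ≡⟨ cong (map inj₁ w₁ ++_)
               (trans (map-++ inj₂ (map inj₁ w₂) _)
                      (cong₂ _++_ (sym (map-∘ w₂)) (sym (map-∘ w₃)))) ⟨
        map inj₁ w₁ ++ map inj₂ (map inj₁ w₂ ++ map inj₂ w₃) ∎)))
      where
      open ≡-Reasoning
      w₁ = word N
      w₂ = word M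
      w₃ = word L
      f = Inverse.to (⊎-assoc 0ℓ (Letter (alphabet N)) (Letter (alphabet M)) (Letter (alphabet L)))

    ∙-identityˡ : ∀ N → ∅ ∙ N ~ N
    ∙-identityˡ N = move (iso (isomorphism ⊥-⊎ (λ { (inj₁ ()) ; (inj₂ _) → refl })
      (trans (sym (map-∘ (word N))) (map-id (word N)))))

    ∙-identityʳ : ∀ N → N ∙ ∅ ~ N
    ∙-identityʳ N = move (iso (isomorphism ⊎-⊥ (λ { (inj₁ _) → refl ; (inj₂ ()) })
      (trans (cong (map (Inverse.to ⊎-⊥)) (++-identityʳ _))
             (trans (sym (map-∘ (word N))) (map-id (word N))))))

    -- All of N ∙ N⁻ is an even symmetric factor of itself; ι exchanges the two
    -- copies of the alphabet.
    ∙-inverseʳ : ∀ N → N ∙ N ⁻ ~ ∅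
    ∙-inverseʳ N =
      ~-trans (reword {q = subst EachTwice N∙N⁻≡weave (twice (N ∙ N ⁻))} N∙N⁻≡weave)
      (~-trans (move (surgery ∇ (even ∷ []) symmetric all ([] ∷ [] ∷ []) {q = no-letters}))
               (move (iso (isomorphism empty (λ A → contradiction (Inverse.to empty A) λ ()) refl))))
      where
      w = word N
      W = word (N ∙ N ⁻)

      ∇ : Nanophrase
      ∇ = record
        { alphabet = alphabet (N ∙ N ⁻)
        ; words    = W ∷ []
        ; twice    = λ B → ↔-trans (↔-sym singleton↔) (twice (N ∙ N ⁻) B)
        }

      even : 2 ∣ length W
      even = divides (length w) (begin
        length W                     ≡⟨ length-++ (map inj₁ w) ⟩
        length (map inj₁ w) + length (map inj₂ (reverse w))
          ≡⟨ cong₂ _+_ (length-map inj₁ w)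
                       (trans (length-map inj₂ (reverse w)) (length-reverse w)) ⟩
        length w + length w          ≡⟨ cong (length w +_) (+-identityʳ _) ⟨
        2 * length w                 ≡⟨ *-comm 2 (length w) ⟩
        length w * 2                 ∎)
        where open ≡-Reasoning

      swap-W : map swap W ≡ reverse W
      swap-W = begin
        map swap W                                  ≡⟨ map-swap w (reverse w) ⟩
        map inj₂ w ++ map inj₁ (reverse w)
          ≡⟨ cong₂ _++_ (trans (cong (map inj₂) (sym (reverse-involutive w)))
                               (reverse-map inj₂ (reverse w)))
                        (reverse-map inj₁ w) ⟩
        reverse (map inj₂ (reverse w)) ++ reverse (map inj₁ w)
          ≡⟨ reverse-++ (map inj₁ w) _ ⟨
        reverse W                                   ∎
        where open ≡-Reasoning

      ε≡0 : ∀ B → Nanophrase.ε ∇ B ≡ 0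
      ε≡0 B with Nanophrase.component ∇ B 0F | Nanophrase.component ∇ B 1F
      ... | 0F | 0F = refl

      symmetric : Nanophrase.Symmetric ∇
      symmetric = record
        { ι        = swap-↔
        ; reverses = swap-W ∷ []
        ; label    = λ B → trans (swap-label B)
                             (cong (λ e → (τ ^ e) (proj (alphabet (N ∙ N ⁻)) B)) (sym (ε≡0 B)))
        }
        where
        swap-label : ∀ B → proj (alphabet (N ∙ N ⁻)) (swap B) ≡ proj (alphabet (N ∙ N ⁻)) B
        swap-label (inj₁ _) = refl
        swap-label (inj₂ _) = refl

      all : alphabet (N ∙ N ⁻) ⊆ alphabet (N ∙ N ⁻)
      all = record { injection = mk↣ id ; label = λ _ → refl }

      N∙N⁻≡weave : W ≡ map id W ++ []
      N∙N⁻≡weave = sym (trans (++-identityʳ _) (map-id W))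

      absurd : {Whatever : Set} → Letter (alphabet (N ∙ N ⁻) ∖ Image all) → Whatever
      absurd (A , Irrelevant.[ A∉ ]) = contradiction-irr A∉ (λ A∉ → A∉ (A , refl))

      no-letters : EachTwice []
      no-letters A = absurd A

      empty : Letter (alphabet (N ∙ N ⁻) ∖ Image all) ↔ ⊥
      empty = mk↔ₛ′ absurd (λ ()) (λ ()) (λ A → absurd A)

    ∙-inverseˡ : ∀ N → N ⁻ ∙ N ~ ∅
    ∙-inverseˡ N = ~-trans
      (reword (cong (λ w → map inj₁ (reverse (word N)) ++ map inj₂ w)
                    (sym (reverse-involutive (word N)))))
      (∙-inverseʳ (N ⁻))

    ⁻-cong : ∀ {N M} → N ~ M → N ⁻ ~ M ⁻
    ⁻-cong {N} {M} N~M =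
      ~-trans (~-sym (∙-identityʳ (N ⁻)))
      (~-trans (∙-congˡ (N ⁻) (~-sym (~-trans (∙-congʳ (M ⁻) N~M) (∙-inverseʳ M))))
      (~-trans (~-sym (∙-assoc (N ⁻) N (M ⁻)))
      (~-trans (∙-congʳ (M ⁻) (∙-inverseˡ N))
               (∙-identityˡ (M ⁻)))))

  𝒩c : Group (lsuc 0ℓ ⊔ a) (lsuc 0ℓ ⊔ a)
  𝒩c = record
    { Carrier = Nanoword
    ; _≈_     = _~_
    ; _∙_     = _∙_
    ; ε       = ∅
    ; _⁻¹     = _⁻
    ; isGroup = record
      { isMonoid = record
        { isSemigroup = record
          { isMagma = record
            { isEquivalence = ~-isEquivalence
            ; ∙-cong        = ∙-cong
            }
          ; assoc = ∙-assoc
          }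
        ; identity = ∙-identityˡ , ∙-identityʳ
        }
      ; inverse = ∙-inverseˡ , ∙-inverseʳ
      ; ⁻¹-cong = ⁻-cong
      }
    }

{-# OPTIONS --safe #-}

-- Fix x₀ in α and give a letter A the sign σ(A) = 1, -1 or 0 according as |A| is x₀,
-- τ x₀ or neither.  Weigh the first and second occurrence of A in a word by -σ(A) and
-- σ(A), and let the index of A be twice the total weight between its two occurrences.
-- For every odd function φ the sum of σ(A) φ(index A) over the letters of
-- a word is a cobordism invariant, additive under concatenation: the symmetry ι of a
-- surgery reverses the weights of each factor word up to sign, so these words have
-- total weight 0 and do not affect the index of the remaining letters, while
-- index(ιA) = -(±index A) and σ(ιA) = ±σ(A) with the same sign, so the contributions of
-- the deleted letters cancel.  With φ supported on ±m, the invariant vanishes on any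
-- given finite set of nanowords once m is large, but not on A B₁⋯Bₖ A Bₖ⋯B₁ with
-- |A| = |Bᵢ| = x₀ and m = 2k, since the index of A is -2k and that of every Bᵢ is 2.
--
-- Equality in α is not decidable, and a point moved by τ cannot be extracted from the
-- hypothesis.  Both obstacles are avoided by proving τ x₀ ≡ x₀ for arbitrary x₀ under
-- the assumption of finite generation: every negation is replaced by an implication
-- into τ x₀ ≡ x₀, relative to which finitely many signs can be chosen.

module Submission where

open import Defs
open import Algebra.Bundles using (Group)
open import Algebra.Definitions using (Involutive)
open import Data.Bool.Base using (Bool; true; false; not; if_then_else_)
open import Data.Fin.Base using (Fin; zero; suc)
open import Data.Fin.Patterns using (0F; 1F)
open import Data.Fin.Permutation using (↔⇒≡)
import Data.Fin.Properties as Fin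
open import Data.Integer.Base using (ℤ; +_; 0ℤ; 1ℤ; -1ℤ; _+_; _-_; _*_; -_; ∣_∣)
import Data.Integer.Properties as ℤ
open import Data.Integer.Tactic.RingSolver using (solve-∀)
import Data.Irrelevant as Irrelevant
open import Data.List.Base
  using (List; []; _∷_; _++_; map; reverse; concat; length; lookup; allFin)
open import Data.List.Membership.Propositional using (_∈_)
open import Data.List.Membership.Propositional.Properties
  using (∈-++⁺ˡ; ∈-++⁺ʳ; ∈-map⁺; ∈-allFin)
open import Data.List.Membership.Propositional.Properties.WithK using (unique⇒irrelevant)
open import Data.List.Properties
  using (map-∘; map-cong; map-id; ++-identityʳ; unfold-reverse; reverse-map; length-tabulate)
open import Data.List.Relation.Binary.BagAndSetEquality using (↭⇒∼bag)
open import Data.List.Relation.Binary.Permutation.Propositional using (prep)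
open import Data.List.Relation.Binary.Permutation.Propositional.Properties using (↭-reverse)
open import Data.List.Relation.Unary.All as All using (All; []; _∷_)
open import Data.List.Relation.Unary.All.Properties as All using (¬All⇒Any¬)
open import Data.List.Relation.Unary.AllPairs as AllPairs using (AllPairs; []; _∷_)
open import Data.List.Relation.Unary.Any as Any using (here; there; satisfied)
open import Data.List.Relation.Unary.Any.Properties using (lookup-index; ∷↔; ++↔)
open import Data.List.Relation.Unary.Unique.Propositional using (Unique)
open import Data.List.Relation.Unary.Unique.Propositional.Properties using (map⁺; allFin⁺)
open import Data.Nat.Base as ℕ using (ℕ; suc; _≤_; s≤s; z≤n; _⊔_)
import Data.Nat.Properties as ℕ
open import Data.Product.Base using (∃; _×_; _,_; proj₁; proj₂; map₁)
open import Data.Refinement using (Refinement; _,_; value)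
open import Data.Sum.Base using (_⊎_; inj₁; inj₂; [_,_])
open import Data.Sum.Function.Propositional using (_⊎-cong_)
open import Data.Sum.Properties using (inj₁-injective; inj₂-injective)
open import Data.Unit.Base using (tt)
open import Data.Vec.Base as Vec using (Vec; []; _∷_)
open import Data.Vec.Relation.Unary.All as VecAll using ([]; _∷_) renaming (All to VecAll)
open import Data.Vec.Relation.Unary.All.Properties using (lookup⁺; lookup⁻)
open import Data.Vec.Relation.Unary.AllPairs using ([]; _∷_) renaming (AllPairs to VecAllPairs)
open import Data.Vec.Relation.Unary.Any as VecAny using (here; there) renaming (Any to VecAny)
import Function.Endo.Propositional as Endo
open import Function.Base using (_∘_; _on_; id; const)
open import Function.Bundles using (_↔_; Inverse; Injection; mk↔ₛ′; mk↣)
open import Function.Properties.Inverse using (↔-sym; ↔-trans; ↔⇒↣)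
open import Level using (0ℓ)
import Relation.Binary.Construct.Closure.Equivalence as Eq
open import Relation.Binary.Definitions using (DecidableEquality)
open import Relation.Binary.PropositionalEquality
  using (_≡_; _≢_; _≗_; refl; sym; trans; cong; cong₂; subst; module ≡-Reasoning)
open import Relation.Binary.PropositionalEquality.WithK using (≡-irrelevant)
open import Relation.Binary.Structures using (IsEquivalence)
open import Relation.Nullary using (¬_; Dec; does; yes; no; contradiction)
open import Relation.Nullary.Decidable using (via-injection; dec-true; dec-false)
open import Relation.Nullary.Negation using (contradiction-irr)
open import Relation.Unary using (Pred; Decidable)

private
  variable
    X Y Z V : Set
    k : ℕ

-- Sums and scans

∑ : (X → ℤ) → List X → ℤ
∑ φ []      = 0ℤ
∑ φ (x ∷ l) = φ x + ∑ φ l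

∑-cong : {φ ψ : X → ℤ} → φ ≗ ψ → ∑ φ ≗ ∑ ψ
∑-cong eq []      = refl
∑-cong eq (x ∷ l) = cong₂ _+_ (eq x) (∑-cong eq l)

∑-zero : {φ : X → ℤ} → (∀ x → φ x ≡ 0ℤ) → ∀ l → ∑ φ l ≡ 0ℤ
∑-zero eq []      = refl
∑-zero eq (x ∷ l) = cong₂ _+_ (eq x) (∑-zero eq l)

∑-++ : (φ : X → ℤ) (u v : List X) → ∑ φ (u ++ v) ≡ ∑ φ u + ∑ φ v
∑-++ φ []      v = sym (ℤ.+-identityˡ _)
∑-++ φ (x ∷ u) v = trans (cong (_+_ (φ x)) (∑-++ φ u v)) (sym (ℤ.+-assoc (φ x) _ _))

∑-map : (φ : Y → ℤ) (f : X → Y) (l : List X) → ∑ φ (map f l) ≡ ∑ (φ ∘ f) l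
∑-map φ f []      = refl
∑-map φ f (x ∷ l) = cong (_+_ (φ (f x))) (∑-map φ f l)

∑-reverse : (φ : X → ℤ) (l : List X) → ∑ φ (reverse l) ≡ ∑ φ l
∑-reverse φ []      = refl
∑-reverse φ (x ∷ l) = begin
  ∑ φ (reverse (x ∷ l))          ≡⟨ cong (∑ φ) (unfold-reverse x l) ⟩
  ∑ φ (reverse l ++ x ∷ [])      ≡⟨ ∑-++ φ (reverse l) _ ⟩
  ∑ φ (reverse l) + (φ x + 0ℤ)   ≡⟨ cong (_+ (φ x + 0ℤ)) (∑-reverse φ l) ⟩
  ∑ φ l + (φ x + 0ℤ)             ≡⟨ lemma (∑ φ l) (φ x) ⟩
  φ x + ∑ φ l                    ∎
  where
  open ≡-Reasoning
  lemma : ∀ s a → s + (a + 0ℤ) ≡ a + s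
  lemma = solve-∀

∑-+ : (φ ψ : X → ℤ) (l : List X) → ∑ (λ x → φ x + ψ x) l ≡ ∑ φ l + ∑ ψ l
∑-+ φ ψ []      = refl
∑-+ φ ψ (x ∷ l) = trans (cong (_+_ (φ x + ψ x)) (∑-+ φ ψ l)) (lemma (φ x) (ψ x) (∑ φ l) (∑ ψ l))
  where
  lemma : ∀ a b c d → (a + b) + (c + d) ≡ (a + c) + (b + d)
  lemma = solve-∀

∑-* : (s : ℤ) (φ : X → ℤ) (l : List X) → ∑ (λ x → s * φ x) l ≡ s * ∑ φ l
∑-* s φ []      = sym (ℤ.*-zeroʳ s)
∑-* s φ (x ∷ l) = trans (cong (_+_ (s * φ x)) (∑-* s φ l)) (sym (ℤ.*-distribˡ-+ s (φ x) _))

∑-neg : (φ : X → ℤ) (l : List X) → ∑ (-_ ∘ φ) l ≡ - ∑ φ l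
∑-neg φ []      = refl
∑-neg φ (x ∷ l) = trans (cong (_+_ (- φ x)) (∑-neg φ l)) (sym (ℤ.neg-distrib-+ (φ x) _))

x≡-x⇒x≡0 : ∀ x → x ≡ - x → x ≡ 0ℤ
x≡-x⇒x≡0 (+ 0)    _ = refl

-- Reversal preserves the sum and `θ` negates it, so the sum equals its own negative.
∑-reflection : {φ : X → ℤ} {θ : X → X} → (∀ x → φ (θ x) ≡ - φ x) →
               ∀ {l} → map θ l ≡ reverse l → ∑ φ l ≡ 0ℤ
∑-reflection {φ = φ} {θ} anti {l} eq = x≡-x⇒x≡0 _ (begin
  ∑ φ l            ≡⟨ ∑-reverse φ l ⟨
  ∑ φ (reverse l)  ≡⟨ cong (∑ φ) eq ⟨
  ∑ φ (map θ l)    ≡⟨ ∑-map φ θ l ⟩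
  ∑ (φ ∘ θ) l      ≡⟨ ∑-cong anti l ⟩
  ∑ (-_ ∘ φ) l     ≡⟨ ∑-neg φ l ⟩
  - ∑ φ l          ∎)
  where open ≡-Reasoning

-- Annotates each entry x with c x plus the sum of K x over the entries before it minus
-- the sum over those after it; c accounts for a surrounding word.
scan : (X → X → ℤ) → (X → ℤ) → List X → List (X × ℤ)
scan K c []      = []
scan K c (x ∷ l) = (x , c x - ∑ (K x) l) ∷ scan K (λ z → c z + K z x) l

scan-cong : (K : X → X → ℤ) {c c′ : X → ℤ} → c ≗ c′ → scan K c ≗ scan K c′
scan-cong K eq []      = refl
scan-cong K eq (x ∷ l) = cong₂ _∷_ (cong (λ d → x , d - ∑ (K x) l) (eq x))
                                   (scan-cong K (λ z → cong (_+ K z x) (eq z)) l)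

-- Each half sees the other only through a sum, which is absorbed into the context: entries to come
-- count negatively, entries passed count positively.
scan-++ : ∀ (K : X → X → ℤ) c u v →
          scan K c (u ++ v) ≡
          scan K (λ z → c z - ∑ (K z) v) u ++ scan K (λ z → c z + ∑ (K z) u) v
scan-++ K c []      v = scan-cong K (λ z → sym (ℤ.+-identityʳ _)) v
scan-++ K c (x ∷ u) v = cong₂ _∷_
  (cong (x ,_) (trans (cong (_-_ (c x)) (∑-++ (K x) u v)) (lemma₁ (c x) _ _)))
  (trans (scan-++ K (λ z → c z + K z x) u v)
    (cong₂ _++_ (scan-cong K (λ z → lemma₂ (c z) (K z x) (∑ (K z) v)) u)
                (scan-cong K (λ z → ℤ.+-assoc (c z) (K z x) _) v)))
  where
  lemma₁ : ∀ a b c → a - (b + c) ≡ (a - c) - b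
  lemma₁ = solve-∀
  lemma₂ : ∀ a b c → (a + b) - c ≡ (a - c) + b
  lemma₂ = solve-∀

negate : X × ℤ → X × ℤ
negate (x , d) = x , - d

-- Reversal exchanges the entries before and after a position, so it changes the sign of every
-- annotation once the context is negated too. This is the reason for taking the difference of the
-- two sums in `scan`.
scan-reverse : ∀ (K : X → X → ℤ) c l →
               scan K c (reverse l) ≡ reverse (map negate (scan K (-_ ∘ c) l))
scan-reverse K c []      = refl
scan-reverse K c (x ∷ l) = begin
  scan K c (reverse (x ∷ l))
    ≡⟨ cong (scan K c) (unfold-reverse x l) ⟩
  scan K c (reverse l ++ x ∷ [])
    ≡⟨ scan-++ K c (reverse l) (x ∷ []) ⟩
  scan K (λ z → c z - (K z x + 0ℤ)) (reverse l) ++ (x , c x + ∑ (K x) (reverse l) - 0ℤ) ∷ []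
    ≡⟨ cong₂ (λ u d → u ++ (x , d) ∷ [])
         (trans (scan-reverse K _ l)
           (cong (reverse ∘ map negate) (scan-cong K (λ z → lemma₁ (c z) (K z x)) l)))
         (trans (cong (λ s → c x + s - 0ℤ) (∑-reverse (K x) l)) (lemma₂ (c x) (∑ (K x) l))) ⟩
  reverse (map negate (scan K (λ z → - c z + K z x) l)) ++ (x , - (- c x - ∑ (K x) l)) ∷ []
    ≡⟨ unfold-reverse _ (map negate (scan K (λ z → - c z + K z x) l)) ⟨
  reverse (map negate (scan K (-_ ∘ c) (x ∷ l))) ∎
  where
  open ≡-Reasoning
  lemma₁ : ∀ a b → - (a - (b + 0ℤ)) ≡ - a + b
  lemma₁ = solve-∀
  lemma₂ : ∀ a b → a + b - 0ℤ ≡ - (- a - b)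
  lemma₂ = solve-∀

-- Required below only of entries at different positions, since `scan` never compares an entry with
-- itself. This matters for a letter `B` that occurs once in a word of a surgery: there `e B` is -1,
-- although the kernel is 1 both at `B`, `B` and at `ι B`, `ι B`.
Compatible : (X → Y) → (X → ℤ) → (Y → Y → ℤ) → (X → X → ℤ) → X → X → Set
Compatible f s K L x y = K (f x) (f y) ≡ s x * L x y × K (f y) (f x) ≡ s y * L y x

scan-map-scaled : ∀ (f : X → Y) s (K : Y → Y → ℤ) (L : X → X → ℤ) {c c′} l →
                  All (λ x → c (f x) ≡ s x * c′ x) l → AllPairs (Compatible f s K L) l →
                  scan K c (map f l) ≡ map (λ (x , d) → f x , s x * d) (scan L c′ l)
scan-map-scaled f s K L []                []       []        = refl
scan-map-scaled f s K L {c} {c′} (x ∷ l) (px ∷ ps) (cx ∷ cs) = cong₂ _∷_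
  (cong (f x ,_) (trans (cong₂ _-_ px (sums cx)) (lemma (s x) (c′ x) _)))
  (scan-map-scaled f s K L l (contexts ps cx) cs)
  where
  lemma : ∀ s a b → s * a - s * b ≡ s * (a - b)
  lemma = solve-∀
  sums : ∀ {l} → All (Compatible f s K L x) l → ∑ (K (f x)) (map f l) ≡ s x * ∑ (L x) l
  sums []             = sym (ℤ.*-zeroʳ (s x))
  sums ((p , _) ∷ cs) = trans (cong₂ _+_ p (sums cs)) (sym (ℤ.*-distribˡ-+ (s x) _ _))
  contexts : ∀ {l} → All (λ x → c (f x) ≡ s x * c′ x) l → All (Compatible f s K L x) l →
             All (λ z → c (f z) + K (f z) (f x) ≡ s z * (c′ z + L z x)) l
  contexts []       []             = []
  contexts {z ∷ _} (p ∷ ps) ((_ , q) ∷ qs) =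
    trans (cong₂ _+_ p q) (sym (ℤ.*-distribˡ-+ (s z) _ _)) ∷ contexts ps qs

scan-map : {f : X → Y} {K : Y → Y → ℤ} {L : X → X → ℤ} {c : Y → ℤ} {c′ : X → ℤ} →
           (∀ x y → K (f x) (f y) ≡ L x y) → (∀ x → c (f x) ≡ c′ x) →
           ∀ l → scan K c (map f l) ≡ map (map₁ f) (scan L c′ l)
scan-map         eq eq′ []      = refl
scan-map {f = f} {K} eq eq′ (x ∷ l) = cong₂ _∷_
  (cong (f x ,_) (cong₂ _-_ (eq′ x) (trans (∑-map (K (f x)) f l) (∑-cong (eq x) l))))
  (scan-map eq (λ z → cong₂ _+_ (eq′ z) (eq z x)) l)

reflect : (X → X) → (X → ℤ) → X × ℤ → X × ℤ
reflect θ s (x , d) = θ x , - (s x * d)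

record Anti (θ : X → X) (s : X → ℤ) (φ : X → ℤ) (x : X) : Set where
  constructor ⟪_⟫
  field
    proof : φ (θ x) ≡ - (s x * φ x)

-- The two sides come from scanning the image under `θ` and scanning the reversed list. The
-- conclusion again says that a map reverses a list, so the lemma can be applied to the annotated
-- list in turn: first for flags, then for levels.
scan-reflection : ∀ (K : X → X → ℤ) θ s {c l} →
  All (Anti θ s c) l → AllPairs (Compatible θ s K K) l → map θ l ≡ reverse l →
  map (reflect θ s) (scan K c l) ≡ reverse (scan K c l)
scan-reflection K θ s {c} {l} anti compatible eq = begin
  map (reflect θ s) S
    ≡⟨ map-∘ S ⟩
  map negate (map (λ (x , d) → θ x , s x * d) S)
    ≡⟨ cong (map negate) (scan-map-scaled θ s K K l
         (All.map (λ {x} p → lemma (s x) (c x) (Anti.proof p)) anti) compatible) ⟨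
  map negate (scan K (-_ ∘ c) (map θ l))
    ≡⟨ cong (map negate ∘ scan K (-_ ∘ c)) eq ⟩
  map negate (scan K (-_ ∘ c) (reverse l))
    ≡⟨ cong (map negate) (scan-reverse K (-_ ∘ c) l) ⟩
  map negate (reverse (map negate (scan K (-_ ∘ -_ ∘ c) l)))
    ≡⟨ cong (map negate ∘ reverse ∘ map negate) (scan-cong K (λ z → ℤ.neg-involutive (c z)) l) ⟩
  map negate (reverse (map negate S))
    ≡⟨ reverse-map negate (map negate S) ⟩
  reverse (map negate (map negate S))
    ≡⟨ cong reverse (map-∘ S) ⟨
  reverse (map (negate ∘ negate) S)
    ≡⟨ cong reverse (trans (map-cong (λ (x , d) → cong (x ,_) (ℤ.neg-involutive d)) S) (map-id S)) ⟩
  reverse S ∎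
  where
  open ≡-Reasoning
  S = scan K c l
  lemma : ∀ s a {b} → b ≡ - (s * a) → - b ≡ s * a
  lemma s a refl = ℤ.neg-involutive (s * a)

-- Scans of words cut into gaps and blocks

weave-∷ : ∀ x (xs : Vec (List X) (suc k)) v vs → weave (x ∷ xs) (v ∷ vs) ≡ x ++ v ++ weave xs vs
weave-∷ x (_ ∷ _) v vs = refl

module _ {Y Z V : Set} (f : Z → Y) (g : V → Y) where

  interleave : Vec (List Z) (suc k) → Vec (List V) k → List Y
  interleave xs vs = weave (Vec.map (map f) xs) (Vec.map (map g) vs)

  ∑-interleave : ∀ φ (xs : Vec (List Z) (suc k)) vs →
    ∑ φ (interleave xs vs) ≡ ∑ (φ ∘ f) (concat (Vec.toList xs)) + ∑ (φ ∘ g) (concat (Vec.toList vs))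
  ∑-interleave φ (x ∷ []) [] = begin
    ∑ φ (map f x)                   ≡⟨ ∑-map φ f x ⟩
    ∑ (φ ∘ f) x                     ≡⟨ ℤ.+-identityʳ _ ⟨
    ∑ (φ ∘ f) x + 0ℤ                ≡⟨ cong (λ l → ∑ (φ ∘ f) l + 0ℤ) (++-identityʳ x) ⟨
    ∑ (φ ∘ f) (x ++ []) + 0ℤ        ∎
    where open ≡-Reasoning
  ∑-interleave φ (x ∷ xs@(_ ∷ _)) (v ∷ vs) = begin
    ∑ φ (map f x ++ map g v ++ interleave xs vs)
      ≡⟨ ∑-++ φ (map f x) _ ⟩
    ∑ φ (map f x) + ∑ φ (map g v ++ interleave xs vs)
      ≡⟨ cong (_+_ (∑ φ (map f x))) (∑-++ φ (map g v) _) ⟩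
    ∑ φ (map f x) + (∑ φ (map g v) + ∑ φ (interleave xs vs))
      ≡⟨ cong₂ _+_ (∑-map φ f x) (cong₂ _+_ (∑-map φ g v) (∑-interleave φ xs vs)) ⟩
    ∑ (φ ∘ f) x + (∑ (φ ∘ g) v + (∑ (φ ∘ f) C + ∑ (φ ∘ g) D))
      ≡⟨ lemma (∑ (φ ∘ f) x) (∑ (φ ∘ g) v) (∑ (φ ∘ f) C) (∑ (φ ∘ g) D) ⟩
    (∑ (φ ∘ f) x + ∑ (φ ∘ f) C) + (∑ (φ ∘ g) v + ∑ (φ ∘ g) D)
      ≡⟨ cong₂ _+_ (∑-++ (φ ∘ f) x C) (∑-++ (φ ∘ g) v D) ⟨
    ∑ (φ ∘ f) (x ++ C) + ∑ (φ ∘ g) (v ++ D) ∎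
    where
    open ≡-Reasoning
    C = concat (Vec.toList xs)
    D = concat (Vec.toList vs)
    lemma : ∀ a b c d → a + (b + (c + d)) ≡ (a + c) + (b + d)
    lemma = solve-∀

  module _ (K : Y → Y → ℤ) where

    after : (Y → ℤ) → List Y → Y → ℤ
    after c l y = c y + ∑ (K y) l

    before : (Y → ℤ) → List Y → Y → ℤ
    before c l y = c y - ∑ (K y) l

    -- `scanGaps` and `scanBlocks` annotate the two families of words separately, each word with the
    -- rest of the whole as context. A scan of an interleaving is then again an interleaving and can
    -- be scanned a second time.
    scanGaps : (Y → ℤ) → Vec (List Z) (suc k) → Vec (List V) k → Vec (List (Z × ℤ)) (suc k)
    scanGaps c (x ∷ [])         []       = scan (K on f) (c ∘ f) x ∷ []
    scanGaps c (x ∷ xs@(_ ∷ _)) (v ∷ vs) =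
      scan (K on f) (before c (map g v ++ interleave xs vs) ∘ f) x ∷
      scanGaps (after (after c (map f x)) (map g v)) xs vs

    scanBlocks : (Y → ℤ) → Vec (List Z) (suc k) → Vec (List V) k → Vec (List (V × ℤ)) k
    scanBlocks c (x ∷ [])         []       = []
    scanBlocks c (x ∷ xs@(_ ∷ _)) (v ∷ vs) =
      scan (K on g) (before (after c (map f x)) (interleave xs vs) ∘ g) v ∷
      scanBlocks (after (after c (map f x)) (map g v)) xs vs

    scan-interleave : ∀ c (xs : Vec (List Z) (suc k)) vs →
      scan K c (interleave xs vs) ≡
      weave (Vec.map (map (map₁ f)) (scanGaps c xs vs)) (Vec.map (map (map₁ g)) (scanBlocks c xs vs))
    scan-interleave c (x ∷ [])         []       = scan-map (λ _ _ → refl) (λ _ → refl) x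
    scan-interleave c (x ∷ xs@(_ ∷ _)) (v ∷ vs) = begin
      scan K c (map f x ++ map g v ++ interleave xs vs)
        ≡⟨ scan-++ K c (map f x) _ ⟩
      scan K (before c (map g v ++ interleave xs vs)) (map f x) ++
      scan K (after c (map f x)) (map g v ++ interleave xs vs)
        ≡⟨ cong₂ _++_ (scan-map (λ _ _ → refl) (λ _ → refl) x)
                      (trans (scan-++ K (after c (map f x)) (map g v) _)
                        (cong₂ _++_ (scan-map (λ _ _ → refl) (λ _ → refl) v)
                                    (scan-interleave _ xs vs))) ⟩
      _ ≡⟨ weave-∷ _ (Vec.map (map (map₁ f)) (scanGaps _ xs vs)) _ _ ⟨
      _ ∎
      where open ≡-Reasoning

    -- A block whose kernel sum against every gap letter is 0 changes no context, so the gaps are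
    -- annotated as if the blocks had been deleted.
    scanGaps-concat : ∀ {c} (xs : Vec (List Z) (suc k)) {vs} →
      VecAll (λ v → ∀ z → ∑ (K (f z) ∘ g) v ≡ 0ℤ) vs →
      concat (Vec.toList (scanGaps c xs vs)) ≡ scan (K on f) (c ∘ f) (concat (Vec.toList xs))
    scanGaps-concat {c = c} (x ∷ []) [] =
      trans (++-identityʳ _) (cong (scan (K on f) (c ∘ f)) (sym (++-identityʳ x)))
    scanGaps-concat {c = c} (x ∷ xs@(_ ∷ _)) {v ∷ vs} (z∑v ∷ z∑vs) = begin
      scan (K on f) (before c (map g v ++ interleave xs vs) ∘ f) x ++
      concat (Vec.toList (scanGaps (after (after c (map f x)) (map g v)) xs vs))
        ≡⟨ cong₂ _++_
             (scan-cong (K on f) (λ z → cong (_-_ (c (f z))) (rest z)) x)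
             (trans (scanGaps-concat xs z∑vs) (scan-cong (K on f) context C)) ⟩
      scan (K on f) (λ z → c (f z) - ∑ (K (f z) ∘ f) C) x ++
      scan (K on f) (λ z → c (f z) + ∑ (K (f z) ∘ f) x) C
        ≡⟨ scan-++ (K on f) (c ∘ f) x C ⟨
      scan (K on f) (c ∘ f) (x ++ C) ∎
      where
      open ≡-Reasoning
      C = concat (Vec.toList xs)
      ∑vs : ∀ {j} {vs : Vec (List V) j} z → VecAll (λ v → ∀ z → ∑ (K (f z) ∘ g) v ≡ 0ℤ) vs →
            ∑ (K (f z) ∘ g) (concat (Vec.toList vs)) ≡ 0ℤ
      ∑vs z []       = refl
      ∑vs z (_∷_ {x = v} p ps) = trans (∑-++ (K (f z) ∘ g) v _) (cong₂ _+_ (p z) (∑vs z ps))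
      rest : ∀ z → ∑ (K (f z)) (map g v ++ interleave xs vs) ≡ ∑ (K (f z) ∘ f) C
      rest z = begin
        ∑ (K (f z)) (map g v ++ interleave xs vs)
          ≡⟨ ∑-++ (K (f z)) (map g v) _ ⟩
        ∑ (K (f z)) (map g v) + ∑ (K (f z)) (interleave xs vs)
          ≡⟨ cong₂ _+_ (trans (∑-map (K (f z)) g v) (z∑v z)) (∑-interleave (K (f z)) xs vs) ⟩
        0ℤ + (∑ (K (f z) ∘ f) C + ∑ (K (f z) ∘ g) (concat (Vec.toList vs)))
          ≡⟨ cong (λ t → 0ℤ + (∑ (K (f z) ∘ f) C + t)) (∑vs z z∑vs) ⟩
        0ℤ + (∑ (K (f z) ∘ f) C + 0ℤ)
          ≡⟨ trans (ℤ.+-identityˡ _) (ℤ.+-identityʳ _) ⟩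
        ∑ (K (f z) ∘ f) C ∎
      context : ∀ z → after (after c (map f x)) (map g v) (f z) ≡ c (f z) + ∑ (K (f z) ∘ f) x
      context z = trans
        (cong₂ (λ s t → c (f z) + s + t) (∑-map (K (f z)) f x) (trans (∑-map (K (f z)) g v) (z∑v z)))
        (ℤ.+-identityʳ _)

    module _ (θ : V → V) (s : V → ℤ)
             (K-anti : ∀ z y → Anti θ s (λ y → K (g y) (f z)) y) where

      private
        anti-+ : ∀ φ ψ {y} → Anti θ s φ y → Anti θ s ψ y → Anti θ s (λ y → φ y + ψ y) y
        anti-+ φ ψ {y} ⟪ p ⟫ ⟪ q ⟫ = ⟪ trans (cong₂ _+_ p q) (lemma (s y) (φ y) (ψ y)) ⟫
          where
          lemma : ∀ s a b → - (s * a) + - (s * b) ≡ - (s * (a + b))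
          lemma = solve-∀

        anti-neg : ∀ φ {y} → Anti θ s φ y → Anti θ s (λ y → - φ y) y
        anti-neg φ {y} ⟪ p ⟫ = ⟪ trans (cong -_ p) (lemma (s y) (φ y)) ⟫
          where
          lemma : ∀ s a → - - (s * a) ≡ - (s * - a)
          lemma = solve-∀

        anti-cong : ∀ {φ ψ y} → φ ≗ ψ → Anti θ s φ y → Anti θ s ψ y
        anti-cong {y = y} eq ⟪ p ⟫ = ⟪ trans (sym (eq (θ y))) (trans p (cong (λ d → - (s y * d)) (eq y))) ⟫

        anti-0 : ∀ {y} → Anti θ s (λ _ → 0ℤ) y
        anti-0 {y} = ⟪ sym (cong -_ (ℤ.*-zeroʳ (s y))) ⟫

        anti-gap : ∀ x {y} → Anti θ s (λ y → ∑ (K (g y)) (map f x)) y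
        anti-gap []      = anti-0
        anti-gap (z ∷ x) = anti-+ _ _ (K-anti z _) (anti-gap x)

        AntiSum : List V → V → Set
        AntiSum v y = Anti θ s (λ y → ∑ (K (g y) ∘ g) v) y

        anti-blocks : ∀ {j} {vs : Vec (List V) j} {y} → VecAll (λ v → AntiSum v y) vs →
                      AntiSum (concat (Vec.toList vs)) y
        anti-blocks []                         = anti-0
        anti-blocks (_∷_ {x = v} {xs = vs} p ps) =
          anti-cong (λ y → sym (∑-++ (K (g y) ∘ g) v (concat (Vec.toList vs))))
                    (anti-+ _ _ p (anti-blocks ps))

        anti-interleave : ∀ {j} (xs : Vec (List Z) (suc j)) {vs} {y} →
          VecAll (λ v → AntiSum v y) vs → Anti θ s (λ y → ∑ (K (g y)) (interleave xs vs)) y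
        anti-interleave xs {vs} ps =
          anti-cong (λ y → sym (∑-interleave (K (g y)) xs vs))
            (anti-+ _ _ (anti-cong (λ y → ∑-map (K (g y)) f (concat (Vec.toList xs)))
                                   (anti-gap (concat (Vec.toList xs))))
                        (anti-blocks ps))

        transpose : ∀ {j v} {P : List V → V → Set} {vs : Vec (List V) j} →
                    VecAll (λ u → All (P u) v) vs → All (λ y → VecAll (λ u → P u y) vs) v
        transpose {v = []}    _  = []
        transpose {v = y ∷ v} ps = VecAll.map All.head ps ∷ transpose (VecAll.map All.tail ps)

      -- The context of a block is a sum over gaps and other blocks. By linearity it obeys the law
      -- `Anti` as soon as each summand does, and then `scan-reflection` applies to the block.
      scanBlocks-reflection : ∀ {c} (xs : Vec (List Z) (suc k)) {vs} →
        VecAll (All (Anti θ s (c ∘ g))) vs →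
        VecAllPairs (λ u v → All (AntiSum v) u × All (AntiSum u) v) vs →
        VecAll (AllPairs (Compatible θ s (K on g) (K on g))) vs →
        VecAll (λ v → map θ v ≡ reverse v) vs →
        VecAll (λ v → map (reflect θ s) v ≡ reverse v) (scanBlocks c xs vs)
      scanBlocks-reflection (x ∷ [])         []         []           []       []       = []
      scanBlocks-reflection {c = c} (x ∷ xs@(_ ∷ _)) {v ∷ vs} (p ∷ ps) (pair ∷ pairs) (q ∷ qs) (r ∷ rs) =
        scan-reflection (K on g) θ s
          (All.zipWith (λ (a , b) → anti-+ _ _ (anti-+ (c ∘ g) _ a (anti-gap x))
                                               (anti-neg _ (anti-interleave xs b)))
                       (p , transpose (VecAll.map proj₁ pair)))
          q r ∷
        -- The gap and the block just passed join the context of all later blocks.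
        scanBlocks-reflection xs
          (VecAll.map (All.zipWith (λ (a , b) →
                anti-+ _ _ (anti-+ (c ∘ g) _ a (anti-gap x))
                           (anti-cong (λ y → sym (∑-map (K (g y)) g v)) b)))
            (VecAll.zip (ps , VecAll.map proj₂ pair)))
          pairs qs rs

-- The invariant

-- With K the Kronecker delta, the flag of an occurrence of a letter is -1 if it is the
-- first occurrence and 1 if it is the second.
flags : (X → X → ℤ) → List X → List (X × ℤ)
flags K = scan K (const 0ℤ)

weight : (X → ℤ) → X × ℤ → ℤ
weight σ (x , δ) = σ x * δ

-- The kernel ignores its first argument, so an entry receives the total weight before it minus the
-- total weight after it. Subtracting the levels at the two occurrences of a letter counts
-- everything between them twice, while their own opposite weights cancel.
levels : (X → ℤ) → List (X × ℤ) → List ((X × ℤ) × ℤ)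
levels σ = scan (λ _ → weight σ) (const 0ℤ)

-- The index is the difference of the levels of the two occurrences; the flags δ serve
-- as the signs.
term : (X → X → ℤ) → X → (X × ℤ) × ℤ → ℤ
term K x ((y , δ) , d) = K x y * (δ * d)

index : (X → X → ℤ) → (X → ℤ) → List X → X → ℤ
index K σ w x = ∑ (term K x) (levels σ (flags K w))

allPairs : {R : X → X → Set} → (∀ x y → R x y) → ∀ l → AllPairs R l
allPairs r []      = []
allPairs r (x ∷ l) = All.universal (r x) l ∷ allPairs r l

allPairsᵛ : {R : X → X → Set} → (∀ x y → R x y) → (l : Vec X k) → VecAllPairs R l
allPairsᵛ r []      = []
allPairsᵛ r (x ∷ l) = VecAll.universal (r x) l ∷ allPairsᵛ r l

module Invariant (φ : ℤ → ℤ) (φ-odd : ∀ n → φ (- n) ≡ - φ n) where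

  contribution : (X → X → ℤ) → (X → ℤ) → List X → X → ℤ
  contribution K σ w x = σ x * φ (index K σ w x)

  -- The sum runs over positions, so each letter of a nanoword is counted twice; this avoids
  -- enumerating the alphabet.
  U : (X → X → ℤ) → (X → ℤ) → List X → ℤ
  U K σ w = ∑ (contribution K σ w) w

  index-map : (f : X → Y) {K : Y → Y → ℤ} {L : X → X → ℤ} {σ : Y → ℤ} {ρ : X → ℤ} →
              (∀ x y → K (f x) (f y) ≡ L x y) → (∀ x → σ (f x) ≡ ρ x) →
              ∀ w x → index K σ (map f w) (f x) ≡ index L ρ w x
  index-map f {K} {L} {σ} {ρ} eq eq′ w x = begin
    ∑ (term K (f x)) (levels σ (flags K (map f w)))
      ≡⟨ cong (∑ (term K (f x)) ∘ levels σ) (scan-map eq (λ _ → refl) w) ⟩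
    ∑ (term K (f x)) (levels σ (map (map₁ f) (flags L w)))
      ≡⟨ cong (∑ (term K (f x)))
           (scan-map (λ _ (y , δ) → cong (_* δ) (eq′ y)) (λ _ → refl) (flags L w)) ⟩
    ∑ (term K (f x)) (map (map₁ (map₁ f)) (levels ρ (flags L w)))
      ≡⟨ ∑-map (term K (f x)) (map₁ (map₁ f)) (levels ρ (flags L w)) ⟩
    ∑ (term K (f x) ∘ map₁ (map₁ f)) (levels ρ (flags L w))
      ≡⟨ ∑-cong (λ ((y , δ) , d) → cong (_* (δ * d)) (eq x y)) (levels ρ (flags L w)) ⟩
    ∑ (term L x) (levels ρ (flags L w)) ∎
    where open ≡-Reasoning

  U-map : (f : X → Y) {K : Y → Y → ℤ} {L : X → X → ℤ} {σ : Y → ℤ} {ρ : X → ℤ} →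
          (∀ x y → K (f x) (f y) ≡ L x y) → (∀ x → σ (f x) ≡ ρ x) →
          ∀ w → U K σ (map f w) ≡ U L ρ w
  U-map f {K} {σ = σ} eq eq′ w = trans (∑-map (contribution K σ (map f w)) f w)
    (∑-cong (λ x → cong₂ (λ s n → s * φ n) (eq′ x) (index-map f {σ = σ} eq eq′ w x)) w)

  -- Deletion of a symmetric factor

  module _ {Y Z V : Set} (f : Z → Y) (g : V → Y) (K : Y → Y → ℤ) (σ : Y → ℤ)
           (ι : V → V) (e : V → ℤ)
           (e-unit : ∀ B → e B ≡ 1ℤ ⊎ e B ≡ -1ℤ)
           (K-fg : ∀ z B → K (f z) (g B) ≡ 0ℤ) (K-gf : ∀ z B → K (g B) (f z) ≡ 0ℤ)
           (K-ι : ∀ A B → K (g (ι A)) (g (ι B)) ≡ K (g A) (g B))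
           (K-e : ∀ A B → K (g A) (g B) * e B ≡ e A * K (g A) (g B))
           (σ-ι : ∀ B → σ (g (ι B)) ≡ e B * σ (g B)) where

    private
      e²≡1 : ∀ B → e B * e B ≡ 1ℤ
      e²≡1 B with e B | e-unit B
      ... | _ | inj₁ refl = refl
      ... | _ | inj₂ refl = refl

      φ-e : ∀ B n → φ (- (e B * n)) ≡ - (e B * φ n)
      φ-e B n with e B | e-unit B
      ... | _ | inj₁ refl = trans (cong (φ ∘ -_) (ℤ.*-identityˡ n))
                              (trans (φ-odd n) (cong -_ (sym (ℤ.*-identityˡ (φ n)))))
      ... | _ | inj₂ refl = trans (cong φ (lemma n)) (sym (lemma (φ n)))
        where
        lemma : ∀ n → - (-1ℤ * n) ≡ n
        lemma n = trans (cong -_ (ℤ.-1*i≡-i n)) (ℤ.neg-involutive n)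

      -- A reflection rearranges the entries of each word, so it may be inserted under the sum.
      ∑-blocks : ∀ {θ : X → X} {ψ χ : X → ℤ} → (∀ x → ψ (θ x) ≡ χ x) → {vs : Vec (List X) k} →
                 VecAll (λ v → map θ v ≡ reverse v) vs →
                 ∑ ψ (concat (Vec.toList vs)) ≡ ∑ χ (concat (Vec.toList vs))
      ∑-blocks eq [] = refl
      ∑-blocks {θ = θ} {ψ} {χ} eq (_∷_ {x = v} {xs = vs} p ps) = begin
        ∑ ψ (v ++ concat (Vec.toList vs))           ≡⟨ ∑-++ ψ v _ ⟩
        ∑ ψ v + ∑ ψ (concat (Vec.toList vs))        ≡⟨ cong₂ _+_ block (∑-blocks eq ps) ⟩
        ∑ χ v + ∑ χ (concat (Vec.toList vs))        ≡⟨ ∑-++ χ v _ ⟨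
        ∑ χ (v ++ concat (Vec.toList vs))           ∎
        where
        open ≡-Reasoning
        block : ∑ ψ v ≡ ∑ χ v
        block = begin
          ∑ ψ v            ≡⟨ ∑-reverse ψ v ⟨
          ∑ ψ (reverse v)  ≡⟨ cong (∑ ψ) p ⟨
          ∑ ψ (map θ v)    ≡⟨ ∑-map ψ θ v ⟩
          ∑ (ψ ∘ θ) v      ≡⟨ ∑-cong eq v ⟩
          ∑ χ v            ∎

    -- Serves the first two moves as well as surgery. Reflection multiplies the flags in the blocks
    -- by `- e` and keeps the levels, so the total contribution of the block letters equals its own
    -- negative. The blocks have total weight 0, so the gap letters keep their indices.
    U-interleave : (xs : Vec (List Z) (suc k)) {vs : Vec (List V) k} →
      VecAllPairs (λ u v → All (Anti ι e (λ B → ∑ (K (g B) ∘ g) v)) u ×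
                           All (Anti ι e (λ B → ∑ (K (g B) ∘ g) u)) v) vs →
      VecAll (AllPairs (Compatible ι e (K on g) (K on g))) vs →
      VecAll (λ v → map ι v ≡ reverse v) vs →
      U K σ (interleave f g xs vs) ≡ U (K on f) (σ ∘ f) (concat (Vec.toList xs))
    U-interleave xs {vs} cross within reversed = begin
      ∑ h (interleave f g xs vs)
        ≡⟨ ∑-interleave f g h xs vs ⟩
      ∑ (h ∘ f) (concat (Vec.toList xs)) + ∑ (h ∘ g) (concat (Vec.toList vs))
        ≡⟨ cong₂ _+_ (∑-cong (λ z → cong (λ n → σ (f z) * φ n) (index-f z)) (concat (Vec.toList xs))) h-g ⟩
      U (K on f) (σ ∘ f) (concat (Vec.toList xs)) + 0ℤ
        ≡⟨ ℤ.+-identityʳ _ ⟩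
      U (K on f) (σ ∘ f) (concat (Vec.toList xs)) ∎
      where
      open ≡-Reasoning
      h = contribution K σ (interleave f g xs vs)
      f₁ : Z × ℤ → Y × ℤ
      f₁ = map₁ f
      g₁ : V × ℤ → Y × ℤ
      g₁ = map₁ g
      f₂ : (Z × ℤ) × ℤ → (Y × ℤ) × ℤ
      f₂ = map₁ f₁
      g₂ : (V × ℤ) × ℤ → (Y × ℤ) × ℤ
      g₂ = map₁ g₁
      θ₁ = reflect ι e
      -- Whatever `e` is, `θ₁` negates weights (`weight-θ`). So the second scan has the constant
      -- scale -1, and `θ₂` leaves the levels unchanged.
      θ₂ = reflect θ₁ (const -1ℤ)
      K₁ : Y × ℤ → Y × ℤ → ℤ
      K₁ _ = weight σ
      xs₁ = scanGaps f g K (const 0ℤ) xs vs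
      vs₁ = scanBlocks f g K (const 0ℤ) xs vs
      xs₂ = scanGaps f₁ g₁ K₁ (const 0ℤ) xs₁ vs₁
      vs₂ = scanBlocks f₁ g₁ K₁ (const 0ℤ) xs₁ vs₁

      cancel : ∀ n → n ≡ - (-1ℤ * n)
      cancel n = sym (trans (cong -_ (ℤ.-1*i≡-i n)) (ℤ.neg-involutive n))

      weight-θ : ∀ p → weight σ (g₁ (θ₁ p)) ≡ -1ℤ * weight σ (g₁ p)
      weight-θ (B , δ) = begin
        σ (g (ι B)) * - (e B * δ)        ≡⟨ cong (_* - (e B * δ)) (σ-ι B) ⟩
        e B * σ (g B) * - (e B * δ)      ≡⟨ lemma (e B) (σ (g B)) δ ⟩
        - (e B * e B * (σ (g B) * δ))    ≡⟨ cong (λ d → - (d * (σ (g B) * δ))) (e²≡1 B) ⟩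
        - (1ℤ * (σ (g B) * δ))           ≡⟨ cong -_ (ℤ.*-identityˡ (σ (g B) * δ)) ⟩
        - (σ (g B) * δ)                  ≡⟨ ℤ.-1*i≡-i (σ (g B) * δ) ⟨
        -1ℤ * (σ (g B) * δ)              ∎
        where
        lemma : ∀ e s d → e * s * - (e * d) ≡ - (e * e * (s * d))
        lemma = solve-∀

      reflection₁ : VecAll (λ v → map θ₁ v ≡ reverse v) vs₁
      reflection₁ = scanBlocks-reflection f g K ι e
        (λ z B → ⟪ trans (K-gf z (ι B)) (sym (cong -_ (trans (cong (_*_ (e B)) (K-gf z B)) (ℤ.*-zeroʳ (e B))))) ⟫)
        xs
        (VecAll.universal (All.universal (λ B → ⟪ sym (cong -_ (ℤ.*-zeroʳ (e B))) ⟫)) vs)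
        cross within reversed

      reflection₂ : VecAll (λ v → map θ₂ v ≡ reverse v) vs₂
      reflection₂ = scanBlocks-reflection f₁ g₁ K₁ θ₁ (const -1ℤ)
        -- The kernel `K₁` ignores its first argument, and a quantity constant in that argument
        -- satisfies `Anti` with scale -1.
        (λ z _ → ⟪ cancel _ ⟫) xs₁
        (VecAll.universal (All.universal (λ _ → ⟪ refl ⟫)) vs₁)
        (allPairsᵛ (λ u v → All.universal (λ _ → ⟪ cancel _ ⟫) u , All.universal (λ _ → ⟪ cancel _ ⟫) v) vs₁)
        (VecAll.universal (allPairs (λ p q → weight-θ q , weight-θ p)) vs₁)
        reflection₁

      levels≡ : levels σ (flags K (interleave f g xs vs)) ≡ interleave f₂ g₂ xs₂ vs₂
      levels≡ = trans (cong (levels σ) (scan-interleave f g K (const 0ℤ) xs vs))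
                      (scan-interleave f₁ g₁ K₁ (const 0ℤ) xs₁ vs₁)

      index≡ : ∀ y → index K σ (interleave f g xs vs) y ≡
               ∑ (term K y ∘ f₂) (concat (Vec.toList xs₂)) + ∑ (term K y ∘ g₂) (concat (Vec.toList vs₂))
      index≡ y = trans (cong (∑ (term K y)) levels≡) (∑-interleave f₂ g₂ (term K y) xs₂ vs₂)

      xs₂-concat : concat (Vec.toList xs₂) ≡ levels (σ ∘ f) (flags (K on f) (concat (Vec.toList xs)))
      xs₂-concat = trans
        (scanGaps-concat f₁ g₁ K₁ xs₁ (VecAll.map (λ eq _ →
          ∑-reflection (λ p → trans (weight-θ p) (ℤ.-1*i≡-i _)) eq) reflection₁))
        (cong (levels (σ ∘ f))
          (scanGaps-concat f g K xs (VecAll.universal (λ v z → ∑-zero (K-fg z) v) vs)))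

      index-f : ∀ z → index K σ (interleave f g xs vs) (f z) ≡
                index (K on f) (σ ∘ f) (concat (Vec.toList xs)) z
      index-f z = begin
        index K σ (interleave f g xs vs) (f z)
          ≡⟨ index≡ (f z) ⟩
        ∑ (term (K on f) z) (concat (Vec.toList xs₂)) +
        ∑ (term K (f z) ∘ g₂) (concat (Vec.toList vs₂))
          ≡⟨ cong₂ _+_ (cong (∑ (term (K on f) z)) xs₂-concat)
               (∑-zero (λ ((B , δ) , d) → cong (_* (δ * d)) (K-fg z B)) (concat (Vec.toList vs₂))) ⟩
        index (K on f) (σ ∘ f) (concat (Vec.toList xs)) z + 0ℤ
          ≡⟨ ℤ.+-identityʳ _ ⟩
        index (K on f) (σ ∘ f) (concat (Vec.toList xs)) z ∎

      index-g : ∀ B → index K σ (interleave f g xs vs) (g B) ≡ ∑ (term K (g B) ∘ g₂) (concat (Vec.toList vs₂))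
      index-g B = trans (index≡ (g B)) (trans
        (cong (_+ ∑ (term K (g B) ∘ g₂) (concat (Vec.toList vs₂)))
          (∑-zero (λ ((z , δ) , d) → cong (_* (δ * d)) (K-gf z B)) (concat (Vec.toList xs₂))))
        (ℤ.+-identityˡ _))

      term-θ : ∀ A p → term K (g (ι A)) (g₂ (θ₂ p)) ≡ - e A * term K (g A) (g₂ p)
      term-θ A ((B , δ) , d) = begin
        K (g (ι A)) (g (ι B)) * (- (e B * δ) * - (-1ℤ * d))
          ≡⟨ cong₂ (λ a b → a * (- (e B * δ) * b)) (K-ι A B) (sym (cancel d)) ⟩
        K (g A) (g B) * (- (e B * δ) * d)
          ≡⟨ lemma₁ (K (g A) (g B)) (e B) δ d ⟩
        - (K (g A) (g B) * e B) * (δ * d)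
          ≡⟨ cong (λ a → - a * (δ * d)) (K-e A B) ⟩
        - (e A * K (g A) (g B)) * (δ * d)
          ≡⟨ lemma₂ (e A) (K (g A) (g B)) (δ * d) ⟩
        - e A * (K (g A) (g B) * (δ * d)) ∎
        where
        lemma₁ : ∀ a b c d → a * (- (b * c) * d) ≡ - (a * b) * (c * d)
        lemma₁ = solve-∀
        lemma₂ : ∀ a b c → - (a * b) * c ≡ - a * (b * c)
        lemma₂ = solve-∀

      index-ι : ∀ B → index K σ (interleave f g xs vs) (g (ι B)) ≡
                - (e B * index K σ (interleave f g xs vs) (g B))
      index-ι B = begin
        index K σ (interleave f g xs vs) (g (ι B))
          ≡⟨ index-g (ι B) ⟩
        ∑ (term K (g (ι B)) ∘ g₂) (concat (Vec.toList vs₂))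
          ≡⟨ ∑-blocks (term-θ B) reflection₂ ⟩
        ∑ (λ p → - e B * term K (g B) (g₂ p)) (concat (Vec.toList vs₂))
          ≡⟨ ∑-* (- e B) (term K (g B) ∘ g₂) (concat (Vec.toList vs₂)) ⟩
        - e B * ∑ (term K (g B) ∘ g₂) (concat (Vec.toList vs₂))
          ≡⟨ cong (_*_ (- e B)) (index-g B) ⟨
        - e B * index K σ (interleave f g xs vs) (g B)
          ≡⟨ ℤ.neg-distribˡ-* (e B) _ ⟨
        - (e B * index K σ (interleave f g xs vs) (g B)) ∎

      h-ι : ∀ B → h (g (ι B)) ≡ - h (g B)
      h-ι B = begin
        σ (g (ι B)) * φ (index K σ (interleave f g xs vs) (g (ι B)))
          ≡⟨ cong₂ (λ s n → s * φ n) (σ-ι B) (index-ι B) ⟩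
        e B * σ (g B) * φ (- (e B * n))
          ≡⟨ cong (_*_ (e B * σ (g B))) (φ-e B n) ⟩
        e B * σ (g B) * - (e B * φ n)
          ≡⟨ lemma (e B) (σ (g B)) (φ n) ⟩
        - (e B * e B * (σ (g B) * φ n))
          ≡⟨ cong (λ d → - (d * (σ (g B) * φ n))) (e²≡1 B) ⟩
        - (1ℤ * (σ (g B) * φ n))
          ≡⟨ cong -_ (ℤ.*-identityˡ (σ (g B) * φ n)) ⟩
        - h (g B) ∎
        where
        n = index K σ (interleave f g xs vs) (g B)
        lemma : ∀ e s d → e * s * - (e * d) ≡ - (e * e * (s * d))
        lemma = solve-∀

      h-g : ∑ (h ∘ g) (concat (Vec.toList vs)) ≡ 0ℤ
      h-g = x≡-x⇒x≡0 _ (trans (∑-blocks h-ι reversed) (∑-neg (h ∘ g) (concat (Vec.toList vs))))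

-- Concatenation and the third move

-- Each pair of entries enters once with either sign, and by the symmetry of the weighted kernel the
-- two parts cancel, leaving only the context. In particular the flags of a word have total weight
-- 0.
∑-weight-scan : (K : X → X → ℤ) (σ : X → ℤ) → (∀ x y → σ x * K x y ≡ σ y * K y x) →
                ∀ {c} l → ∑ (weight σ) (scan K c l) ≡ ∑ (λ x → σ x * c x) l
∑-weight-scan K σ K-sym []          = refl
∑-weight-scan K σ K-sym {c} (x ∷ l) = begin
  σ x * (c x - ∑ (K x) l) + ∑ (weight σ) (scan K (λ z → c z + K z x) l)
    ≡⟨ cong (_+_ (σ x * (c x - ∑ (K x) l))) (∑-weight-scan K σ K-sym l) ⟩
  σ x * (c x - ∑ (K x) l) + ∑ (λ z → σ z * (c z + K z x)) l
    ≡⟨ cong (_+_ (σ x * (c x - ∑ (K x) l)))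
         (trans (∑-cong (λ z → trans (ℤ.*-distribˡ-+ (σ z) (c z) (K z x))
                                     (cong (_+_ (σ z * c z)) (K-sym z x))) l)
           (trans (∑-+ (λ z → σ z * c z) (λ z → σ x * K x z) l)
             (cong (_+_ (∑ (λ z → σ z * c z) l)) (∑-* (σ x) (K x) l)))) ⟩
  σ x * (c x - ∑ (K x) l) + (∑ (λ z → σ z * c z) l + σ x * ∑ (K x) l)
    ≡⟨ lemma (σ x) (c x) (∑ (K x) l) _ ⟩
  σ x * c x + ∑ (λ z → σ z * c z) l ∎
  where
  open ≡-Reasoning
  lemma : ∀ s a b t → s * (a - b) + (t + s * b) ≡ s * a + t
  lemma = solve-∀

module _ (f : X → Z) (g : Y → Z) (K : Z → Z → ℤ) (σ : Z → ℤ)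
         (K-fg : ∀ x y → K (f x) (g y) ≡ 0ℤ) (K-gf : ∀ x y → K (g y) (f x) ≡ 0ℤ) where

  scan-disjoint : ∀ u v → flags K (map f u ++ map g v) ≡
                  map (map₁ f) (flags (K on f) u) ++ map (map₁ g) (flags (K on g) v)
  scan-disjoint u v = trans (scan-++ K (const 0ℤ) (map f u) (map g v))
    (cong₂ _++_
      (scan-map (λ _ _ → refl)
        (λ x → cong (_-_ 0ℤ) (trans (∑-map (K (f x)) g v) (∑-zero (K-fg x) v))) u)
      (scan-map (λ _ _ → refl)
        (λ y → cong (_+_ 0ℤ) (trans (∑-map (K (g y)) f u) (∑-zero (λ x → K-gf x y) u))) v))

  module _ (K-sym : ∀ x y → σ x * K x y ≡ σ y * K y x) where

    -- To each level the other word contributes plus or minus its total weight, which is 0 by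
    -- `∑-weight-scan`.
    levels-disjoint : ∀ u v → levels σ (flags K (map f u ++ map g v)) ≡
                      map (map₁ (map₁ f)) (levels (σ ∘ f) (flags (K on f) u)) ++
                      map (map₁ (map₁ g)) (levels (σ ∘ g) (flags (K on g) v))
    levels-disjoint u v = trans (cong (levels σ) (scan-disjoint u v))
      (trans (scan-++ (λ _ → weight σ) (const 0ℤ) (map (map₁ f) (flags (K on f) u)) _)
        (cong₂ _++_
          (scan-map (λ _ _ → refl) (λ _ → cong (_-_ 0ℤ) (balanced g v)) (flags (K on f) u))
          (scan-map (λ _ _ → refl) (λ _ → cong (_+_ 0ℤ) (balanced f u)) (flags (K on g) v))))
      where
      balanced : ∀ {V} (h : V → Z) (w : List V) →
                 ∑ (weight σ) (map (map₁ h) (flags (K on h) w)) ≡ 0ℤ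
      balanced h w = trans (∑-map (weight σ) (map₁ h) (flags (K on h) w))
        (trans (∑-weight-scan (K on h) (σ ∘ h) (λ x y → K-sym (h x) (h y)) w)
               (∑-zero (λ x → ℤ.*-zeroʳ (σ (h x))) w))

    index-disjointˡ : ∀ u v x → index K σ (map f u ++ map g v) (f x) ≡ index (K on f) (σ ∘ f) u x
    index-disjointˡ u v x = begin
      index K σ (map f u ++ map g v) (f x)
        ≡⟨ trans (cong (∑ (term K (f x))) (levels-disjoint u v))
                 (∑-++ (term K (f x)) (map (map₁ (map₁ f)) (levels (σ ∘ f) (flags (K on f) u))) _) ⟩
      ∑ (term K (f x)) (map (map₁ (map₁ f)) (levels (σ ∘ f) (flags (K on f) u))) +
      ∑ (term K (f x)) (map (map₁ (map₁ g)) (levels (σ ∘ g) (flags (K on g) v)))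
        ≡⟨ cong₂ _+_
             (∑-map (term K (f x)) (map₁ (map₁ f)) (levels (σ ∘ f) (flags (K on f) u)))
             (trans (∑-map (term K (f x)) (map₁ (map₁ g)) L)
                    (∑-zero (λ ((y , δ) , d) → cong (_* (δ * d)) (K-fg x y)) L)) ⟩
      index (K on f) (σ ∘ f) u x + 0ℤ
        ≡⟨ ℤ.+-identityʳ _ ⟩
      index (K on f) (σ ∘ f) u x ∎
      where
      open ≡-Reasoning
      L = levels (σ ∘ g) (flags (K on g) v)

    index-disjointʳ : ∀ u v y → index K σ (map f u ++ map g v) (g y) ≡ index (K on g) (σ ∘ g) v y
    index-disjointʳ u v y = begin
      index K σ (map f u ++ map g v) (g y)
        ≡⟨ trans (cong (∑ (term K (g y))) (levels-disjoint u v))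
                 (∑-++ (term K (g y)) (map (map₁ (map₁ f)) (levels (σ ∘ f) (flags (K on f) u))) _) ⟩
      ∑ (term K (g y)) (map (map₁ (map₁ f)) (levels (σ ∘ f) (flags (K on f) u))) +
      ∑ (term K (g y)) (map (map₁ (map₁ g)) (levels (σ ∘ g) (flags (K on g) v)))
        ≡⟨ cong₂ _+_
             (trans (∑-map (term K (g y)) (map₁ (map₁ f)) L)
                    (∑-zero (λ ((x , δ) , d) → cong (_* (δ * d)) (K-gf x y)) L))
             (∑-map (term K (g y)) (map₁ (map₁ g)) (levels (σ ∘ g) (flags (K on g) v))) ⟩
      0ℤ + index (K on g) (σ ∘ g) v y
        ≡⟨ ℤ.+-identityˡ _ ⟩
      index (K on g) (σ ∘ g) v y ∎
      where
      open ≡-Reasoning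
      L = levels (σ ∘ f) (flags (K on f) u)

-- As `p` and `q` do not see each other, they are annotated by `u` and `r` alone, and the other
-- entries depend on them only through `K z p + K z q`. So exchanging `p` and `q` changes
-- annotations only up to commutativity.
scan-pair : ∀ (K : X → X → ℤ) c u {p q} r → K p q ≡ 0ℤ → K q p ≡ 0ℤ →
  scan K c (u ++ p ∷ q ∷ r) ≡
  scan K (λ z → c z - (K z p + K z q + ∑ (K z) r)) u ++
  (p , c p + ∑ (K p) u - ∑ (K p) r) ∷ (q , c q + ∑ (K q) u - ∑ (K q) r) ∷
  scan K (λ z → c z + ∑ (K z) u + (K z p + K z q)) r
scan-pair K c u {p} {q} r Kpq Kqp = trans (scan-++ K c u (p ∷ q ∷ r)) (cong₂ _++_
  (scan-cong K (λ z → cong (_-_ (c z)) (sym (ℤ.+-assoc (K z p) (K z q) _))) u)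
  (cong₂ _∷_ (cong (λ d → p , c p + ∑ (K p) u - d) (trans (cong (_+ ∑ (K p) r) Kpq) (ℤ.+-identityˡ _)))
    (cong₂ _∷_ (cong (λ d → q , d - ∑ (K q) r)
                     (trans (cong (_+_ (c q + ∑ (K q) u)) Kqp) (ℤ.+-identityʳ (c q + ∑ (K q) u))))
      (scan-cong K (λ z → ℤ.+-assoc (c z + ∑ (K z) u) (K z p) (K z q)) r))))

module _ (K : X → X → ℤ) (σ : X → ℤ) (e : X) where

  private
    K₁ : X × ℤ → X × ℤ → ℤ
    K₁ _ = weight σ

  -- Exchanging two adjacent entries alters only their own two levels, each by twice the weight of
  -- the other; this is the resulting change of the index of `e`.
  swapTerm : X × ℤ → X × ℤ → ℤ
  swapTerm (A , a) (B , b) = K e B * (b * (+ 2 * (σ A * a))) - K e A * (a * (+ 2 * (σ B * b)))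

  -- ρ is the change of the index of e caused by replacing s with r, whatever
  -- precedes them.
  record Shift (r s : List (X × ℤ)) (ρ : ℤ) : Set where
    constructor shift
    field
      same-weight : ∑ (weight σ) r ≡ ∑ (weight σ) s
      difference  : ∀ c → ∑ (term K e) (scan K₁ c r) ≡ ∑ (term K e) (scan K₁ c s) + ρ

  shift-refl : ∀ r → Shift r r 0ℤ
  shift-refl r = shift refl (λ c → sym (ℤ.+-identityʳ _))

  -- Equal weights of `r` and `s` keep the levels of the earlier entries, and the exchange reaches
  -- the later ones only as a reordering of their context. So the effects of several exchanges add
  -- up.
  shift-swap : ∀ u p q {r s ρ} → Shift r s ρ →
               Shift (u ++ p ∷ q ∷ r) (u ++ q ∷ p ∷ s) (swapTerm p q + ρ)
  shift-swap u p@(A , a) q@(B , b) {r} {s} {ρ} (shift same diff) = shift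
    (begin
      ∑ (weight σ) (u ++ p ∷ q ∷ r)
        ≡⟨ ∑-++ (weight σ) u _ ⟩
      ∑ (weight σ) u + (σ A * a + (σ B * b + ∑ (weight σ) r))
        ≡⟨ cong (_+_ (∑ (weight σ) u)) (trans (cong (λ t → σ A * a + (σ B * b + t)) same)
                                              (exchange (σ A * a) (σ B * b) _)) ⟩
      ∑ (weight σ) u + (σ B * b + (σ A * a + ∑ (weight σ) s))
        ≡⟨ ∑-++ (weight σ) u _ ⟨
      ∑ (weight σ) (u ++ q ∷ p ∷ s) ∎)
    (λ c → begin
      ∑ t (scan K₁ c (u ++ p ∷ q ∷ r))
        ≡⟨ trans (cong (∑ t) (scan-++ K₁ c u (p ∷ q ∷ r)))
                 (∑-++ t (scan K₁ (λ z → c z - (wp + (wq + ∑ (weight σ) r))) u) _) ⟩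
      ∑ t (scan K₁ (λ z → c z - (wp + (wq + ∑ (weight σ) r))) u) +
      (K e A * (a * (c p + S - (wq + ∑ (weight σ) r))) +
       (K e B * (b * (c q + S + wp - ∑ (weight σ) r)) +
        ∑ t (scan K₁ (λ z → c z + S + wp + wq) r)))
        ≡⟨ cong₂ _+_
             (cong (∑ t) (scan-cong K₁ (λ z → cong (_-_ (c z))
               (trans (cong (λ t → wp + (wq + t)) same) (exchange wp wq _))) u))
             (cong₂ _+_ (cong (λ t → K e A * (a * (c p + S - (wq + t)))) same)
               (cong₂ _+_ (cong (λ t → K e B * (b * (c q + S + wp - t))) same)
                 (trans (cong (∑ t) (scan-cong K₁ (λ z → lemma₁ (c z + S) wp wq) r)) (diff _)))) ⟩
      T₀ c + (K e A * (a * (c p + S - (wq + R))) + (K e B * (b * (c q + S + wp - R)) + (T₁ c + ρ)))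
        ≡⟨ lemma₂ (T₀ c) (K e A) a (c p) S wq R (K e B) b (c q) wp (T₁ c) ρ ⟩
      T₀ c + (K e B * (b * (c q + S - (wp + R))) + (K e A * (a * (c p + S + wq - R)) + T₁ c)) +
      (K e B * (b * (+ 2 * wp)) - K e A * (a * (+ 2 * wq)) + ρ)
        ≡⟨ cong (_+ (swapTerm p q + ρ))
             (trans (cong (∑ t) (scan-++ K₁ c u (q ∷ p ∷ s)))
                    (∑-++ t (scan K₁ (λ z → c z - (wq + (wp + ∑ (weight σ) s))) u) _)) ⟨
      ∑ t (scan K₁ c (u ++ q ∷ p ∷ s)) + (swapTerm p q + ρ) ∎)
    where
    open ≡-Reasoning
    t  = term K e
    wp = σ A * a
    wq = σ B * b
    S  = ∑ (weight σ) u
    R  = ∑ (weight σ) s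
    T₀ : (X × ℤ → ℤ) → ℤ
    T₀ c = ∑ t (scan K₁ (λ z → c z - (wq + (wp + R))) u)
    T₁ : (X × ℤ → ℤ) → ℤ
    T₁ c = ∑ t (scan K₁ (λ z → c z + S + wq + wp) s)
    exchange : ∀ a b c → a + (b + c) ≡ b + (a + c)
    exchange = solve-∀
    lemma₁ : ∀ a b c → a + b + c ≡ a + c + b
    lemma₁ = solve-∀
    lemma₂ : ∀ T₀ kA a cp S wq R kB b cq wp T₁ ρ →
      T₀ + (kA * (a * (cp + S - (wq + R))) + (kB * (b * (cq + S + wp - R)) + (T₁ + ρ))) ≡
      T₀ + (kB * (b * (cq + S - (wp + R))) + (kA * (a * (cp + S + wq - R)) + T₁)) +
      (kB * (b * (+ 2 * wp)) - kA * (a * (+ 2 * wq)) + ρ)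
    lemma₂ = solve-∀

∑-swap : ∀ (φ : X → ℤ) u p q {r s} → ∑ φ r ≡ ∑ φ s → ∑ φ (u ++ p ∷ q ∷ r) ≡ ∑ φ (u ++ q ∷ p ∷ s)
∑-swap φ u p q {r} {s} eq = begin
  ∑ φ (u ++ p ∷ q ∷ r)              ≡⟨ ∑-++ φ u _ ⟩
  ∑ φ u + (φ p + (φ q + ∑ φ r))     ≡⟨ cong (λ a → ∑ φ u + (φ p + (φ q + a))) eq ⟩
  ∑ φ u + (φ p + (φ q + ∑ φ s))     ≡⟨ cong (_+_ (∑ φ u)) (lemma (φ p) (φ q) (∑ φ s)) ⟩
  ∑ φ u + (φ q + (φ p + ∑ φ s))     ≡⟨ ∑-++ φ u _ ⟨
  ∑ φ (u ++ q ∷ p ∷ s)              ∎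
  where
  open ≡-Reasoning
  lemma : ∀ a b c → a + (b + c) ≡ b + (a + c)
  lemma = solve-∀

word₃ : (x y z t : List X) → X → X → X → X → X → X → List X
word₃ x y z t p q r s u v = x ++ p ∷ q ∷ y ++ r ∷ s ∷ z ++ u ∷ v ∷ t

record Absent (K : X → X → ℤ) (x y z t : List X) (A : X) : Set where
  field
    ∉x : ∑ (K A) x ≡ 0ℤ
    ∉y : ∑ (K A) y ≡ 0ℤ
    ∉z : ∑ (K A) z ≡ 0ℤ
    ∉t : ∑ (K A) t ≡ 0ℤ

module _ (K : X → X → ℤ) {x y z t : List X} {A B C : X}
         (KAA : K A A ≡ 1ℤ) (KBB : K B B ≡ 1ℤ) (KCC : K C C ≡ 1ℤ)
         (KAB : K A B ≡ 0ℤ) (KBA : K B A ≡ 0ℤ) (KAC : K A C ≡ 0ℤ)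
         (KCA : K C A ≡ 0ℤ) (KBC : K B C ≡ 0ℤ) (KCB : K C B ≡ 0ℤ)
         (absent-A : Absent K x y z t A) (absent-B : Absent K x y z t B)
         (absent-C : Absent K x y z t C) where

  private
    W₁ = word₃ x y z t A B A C B C
    W₂ = word₃ x y z t B A C A C B

    r₂ = z ++ B ∷ C ∷ t
    r₁ = y ++ A ∷ C ∷ r₂
    s₂ = z ++ C ∷ B ∷ t
    s₁ = y ++ C ∷ A ∷ s₂

    ∑r₂ : ∀ D → ∑ (K D) r₂ ≡ ∑ (K D) s₂
    ∑r₂ D = ∑-swap (K D) z B C refl

    ∑r₁ : ∀ D → ∑ (K D) r₁ ≡ ∑ (K D) s₁
    ∑r₁ D = ∑-swap (K D) y A C (∑r₂ D)

    gap : (X → ℤ) → X → X → List X → X → ℤ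
    gap c p q r D = c D - (K D p + K D q + ∑ (K D) r)

    next : (X → ℤ) → List X → X → X → X → ℤ
    next c u p q D = c D + ∑ (K D) u + (K D p + K D q)

    next-cong : ∀ c c′ u p q → c ≗ c′ → next c u p q ≗ next c′ u q p
    next-cong c c′ u p q eq D = cong₂ (λ a b → a + ∑ (K D) u + b) (eq D) (ℤ.+-comm (K D p) (K D q))

    gap-cong : ∀ c c′ p q r r′ → c ≗ c′ → (∀ D → ∑ (K D) r ≡ ∑ (K D) r′) → gap c p q r ≗ gap c′ q p r′
    gap-cong c c′ p q r r′ eq eq′ D = cong₂ _-_ (eq D) (cong₂ _+_ (ℤ.+-comm (K D p) (K D q)) (eq′ D))

    c₁ c₂ c₃ d₁ d₂ d₃ : X → ℤ
    c₁ = next (const 0ℤ) x A B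
    c₂ = next c₁ y A C
    c₃ = next c₂ z B C
    d₁ = next (const 0ℤ) x B A
    d₂ = next d₁ y C A
    d₃ = next d₂ z C B

    d₁≗c₁ : d₁ ≗ c₁
    d₁≗c₁ = next-cong (const 0ℤ) (const 0ℤ) x B A (λ _ → refl)

    d₂≗c₂ : d₂ ≗ c₂
    d₂≗c₂ = next-cong d₁ c₁ y C A d₁≗c₁

    d₃≗c₃ : d₃ ≗ c₃
    d₃≗c₃ = next-cong d₂ c₂ z C B d₂≗c₂

    x̂ = scan K (gap (const 0ℤ) A B r₁) x
    ŷ = scan K (gap c₁ A C r₂) y
    ẑ = scan K (gap c₂ B C t) z
    t̂ = scan K c₃ t

    ∑≡ : ∀ {D} (φ : X → ℤ) u p q r → ∑ φ u ≡ 0ℤ → ∑ φ r ≡ D → ∑ φ (u ++ p ∷ q ∷ r) ≡ φ p + (φ q + D)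
    ∑≡ φ u p q r ∑u ∑r = trans (∑-++ φ u (p ∷ q ∷ r))
      (trans (cong₂ (λ a b → a + (φ p + (φ q + b))) ∑u ∑r) (ℤ.+-identityˡ _))

    -- The annotations that `D` would receive at the first, second and third of the exchanged pairs;
    -- they are evaluated below at `A`, `B` and `C`.
    module Values {D} (absent : Absent K x y z t D) where
      open Absent absent

      R₂ : ∑ (K D) r₂ ≡ K D B + (K D C + 0ℤ)
      R₂ = ∑≡ (K D) z B C t ∉z ∉t

      R₁ : ∑ (K D) r₁ ≡ K D A + (K D C + (K D B + (K D C + 0ℤ)))
      R₁ = ∑≡ (K D) y A C r₂ ∉y R₂

      δ₁ : 0ℤ + ∑ (K D) x - ∑ (K D) r₁ ≡ 0ℤ - (K D A + (K D C + (K D B + (K D C + 0ℤ))))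
      δ₁ = cong₂ (λ a b → 0ℤ + a - b) ∉x R₁

      δ₂ : c₁ D + ∑ (K D) y - ∑ (K D) r₂ ≡ K D A + K D B - (K D B + (K D C + 0ℤ))
      δ₂ = trans (cong₂ (λ a b → 0ℤ + a + (K D A + K D B) + b - ∑ (K D) r₂) ∉x ∉y)
        (cong₂ _-_ (lemma (K D A + K D B)) R₂)
        where
        lemma : ∀ a → 0ℤ + 0ℤ + a + 0ℤ ≡ a
        lemma = solve-∀

      δ₃ : c₂ D + ∑ (K D) z - ∑ (K D) t ≡ K D A + K D B + (K D A + K D C)
      δ₃ = trans (cong₂ (λ a b → 0ℤ + a + (K D A + K D B) + b + (K D A + K D C) + ∑ (K D) z - ∑ (K D) t) ∉x ∉y)
        (trans (cong₂ (λ a b → 0ℤ + 0ℤ + (K D A + K D B) + 0ℤ + (K D A + K D C) + a - b) ∉z ∉t)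
          (lemma (K D A + K D B) (K D A + K D C)))
        where
        lemma : ∀ a b → 0ℤ + 0ℤ + a + 0ℤ + b + 0ℤ - 0ℤ ≡ a + b
        lemma = solve-∀

    a₁ : 0ℤ + ∑ (K A) x - ∑ (K A) r₁ ≡ -1ℤ
    a₁ = trans (Values.δ₁ absent-A)
      (cong (_-_ 0ℤ) (cong₂ _+_ KAA (cong₂ _+_ KAC (cong₂ _+_ KAB (cong (_+ 0ℤ) KAC)))))

    b₁ : 0ℤ + ∑ (K B) x - ∑ (K B) r₁ ≡ -1ℤ
    b₁ = trans (Values.δ₁ absent-B)
      (cong (_-_ 0ℤ) (cong₂ _+_ KBA (cong₂ _+_ KBC (cong₂ _+_ KBB (cong (_+ 0ℤ) KBC)))))

    a₂ : c₁ A + ∑ (K A) y - ∑ (K A) r₂ ≡ 1ℤ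
    a₂ = trans (Values.δ₂ absent-A) (cong₂ _-_ (cong₂ _+_ KAA KAB) (cong₂ _+_ KAB (cong (_+ 0ℤ) KAC)))

    γ₁ : c₁ C + ∑ (K C) y - ∑ (K C) r₂ ≡ -1ℤ
    γ₁ = trans (Values.δ₂ absent-C) (cong₂ _-_ (cong₂ _+_ KCA KCB) (cong₂ _+_ KCB (cong (_+ 0ℤ) KCC)))

    b₂ : c₂ B + ∑ (K B) z - ∑ (K B) t ≡ 1ℤ
    b₂ = trans (Values.δ₃ absent-B) (cong₂ _+_ (cong₂ _+_ KBA KBB) (cong₂ _+_ KBA KBC))

    γ₂ : c₂ C + ∑ (K C) z - ∑ (K C) t ≡ 1ℤ
    γ₂ = trans (Values.δ₃ absent-C) (cong₂ _+_ (cong₂ _+_ KCA KCB) (cong₂ _+_ KCA KCC))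

    block : ∀ {p q : X} {a a′ b b′ : ℤ} {u u′ v v′} → u ≡ u′ → a ≡ a′ → b ≡ b′ → v ≡ v′ →
            u ++ (p , a) ∷ (q , b) ∷ v ≡ u′ ++ (p , a′) ∷ (q , b′) ∷ v′
    block refl refl refl refl = refl

    flags₁ : flags K W₁ ≡ word₃ x̂ ŷ ẑ t̂ (A , -1ℤ) (B , -1ℤ) (A , 1ℤ) (C , -1ℤ) (B , 1ℤ) (C , 1ℤ)
    flags₁ =
      trans (scan-pair K (const 0ℤ) x r₁ KAB KBA) (block refl a₁ b₁
      (trans (scan-pair K c₁ y r₂ KAC KCA) (block refl a₂ γ₁
      (trans (scan-pair K c₂ z t KBC KCB) (block refl b₂ γ₂ refl)))))

    -- Only distinct letters are exchanged, so no first occurrence becomes a second one. All flags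
    -- are as in `flags₁`, and the two lists differ by three adjacent exchanges.
    flags₂ : flags K W₂ ≡ word₃ x̂ ŷ ẑ t̂ (B , -1ℤ) (A , -1ℤ) (C , -1ℤ) (A , 1ℤ) (C , 1ℤ) (B , 1ℤ)
    flags₂ =
      trans (scan-pair K (const 0ℤ) x s₁ KBA KAB) (block
        (scan-cong K (gap-cong (const 0ℤ) (const 0ℤ) B A s₁ r₁ (λ _ → refl) (λ D → sym (∑r₁ D))) x)
        (trans (cong (_-_ (0ℤ + ∑ (K B) x)) (sym (∑r₁ B))) b₁)
        (trans (cong (_-_ (0ℤ + ∑ (K A) x)) (sym (∑r₁ A))) a₁)
      (trans (scan-pair K d₁ y s₂ KCA KAC) (block
        (scan-cong K (gap-cong d₁ c₁ C A s₂ r₂ d₁≗c₁ (λ D → sym (∑r₂ D))) y)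
        (trans (cong₂ (λ a b → a + ∑ (K C) y - b) (d₁≗c₁ C) (sym (∑r₂ C))) γ₁)
        (trans (cong₂ (λ a b → a + ∑ (K A) y - b) (d₁≗c₁ A) (sym (∑r₂ A))) a₂)
      (trans (scan-pair K d₂ z t KCB KBC) (block
        (scan-cong K (gap-cong d₂ c₂ C B t t d₂≗c₂ (λ _ → refl)) z)
        (trans (cong (λ a → a + ∑ (K C) z - ∑ (K C) t) (d₂≗c₂ C)) γ₂)
        (trans (cong (λ a → a + ∑ (K B) z - ∑ (K B) t) (d₂≗c₂ B)) b₂)
        (scan-cong K d₃≗c₃ t))))))

  module _ (σ : X → ℤ) (σA≡σB : σ A ≡ σ B) (σB≡σC : σ B ≡ σ C) where

    index-move₃ : ∀ D → index K σ W₁ D ≡ index K σ W₂ D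
    index-move₃ D = begin
      ∑ (term K D) (levels σ (flags K W₁))
        ≡⟨ cong (∑ (term K D) ∘ levels σ) flags₁ ⟩
      ∑ (term K D) (levels σ (word₃ x̂ ŷ ẑ t̂ (A , -1ℤ) (B , -1ℤ) (A , 1ℤ) (C , -1ℤ) (B , 1ℤ) (C , 1ℤ)))
        ≡⟨ Shift.difference shifts (const 0ℤ) ⟩
      ∑ (term K D) (levels σ (word₃ x̂ ŷ ẑ t̂ (B , -1ℤ) (A , -1ℤ) (C , -1ℤ) (A , 1ℤ) (C , 1ℤ) (B , 1ℤ))) + ρ
        ≡⟨ cong₂ _+_ (cong (∑ (term K D) ∘ levels σ) (sym flags₂)) ρ≡0 ⟩
      ∑ (term K D) (levels σ (flags K W₂)) + 0ℤ
        ≡⟨ ℤ.+-identityʳ _ ⟩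
      ∑ (term K D) (levels σ (flags K W₂)) ∎
      where
      open ≡-Reasoning
      swaps : ℤ → ℤ → ℤ → ℤ → ℤ → ℤ → ℤ
      swaps kA kB kC a b c =
        kB * (-1ℤ * (+ 2 * (a * -1ℤ))) - kA * (-1ℤ * (+ 2 * (b * -1ℤ))) +
        (kC * (-1ℤ * (+ 2 * (a * 1ℤ))) - kA * (1ℤ * (+ 2 * (c * -1ℤ))) +
        (kC * (1ℤ * (+ 2 * (b * 1ℤ))) - kB * (1ℤ * (+ 2 * (c * 1ℤ))) + 0ℤ))
      ρ = swaps (K D A) (K D B) (K D C) (σ A) (σ B) (σ C)
      shifts : Shift K σ D
        (word₃ x̂ ŷ ẑ t̂ (A , -1ℤ) (B , -1ℤ) (A , 1ℤ) (C , -1ℤ) (B , 1ℤ) (C , 1ℤ))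
        (word₃ x̂ ŷ ẑ t̂ (B , -1ℤ) (A , -1ℤ) (C , -1ℤ) (A , 1ℤ) (C , 1ℤ) (B , 1ℤ)) ρ
      shifts = shift-swap K σ D x̂ (A , -1ℤ) (B , -1ℤ) (shift-swap K σ D ŷ (A , 1ℤ) (C , -1ℤ)
                 (shift-swap K σ D ẑ (B , 1ℤ) (C , 1ℤ) (shift-refl K σ D t̂)))
      -- For equal weights each of `A`, `B`, `C` takes part in two exchanges, which have opposite
      -- effects on its index.
      lemma : ∀ kA kB kC s →
        kB * (-1ℤ * (+ 2 * (s * -1ℤ))) - kA * (-1ℤ * (+ 2 * (s * -1ℤ))) +
        (kC * (-1ℤ * (+ 2 * (s * 1ℤ))) - kA * (1ℤ * (+ 2 * (s * -1ℤ))) +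
        (kC * (1ℤ * (+ 2 * (s * 1ℤ))) - kB * (1ℤ * (+ 2 * (s * 1ℤ))) + 0ℤ)) ≡ 0ℤ
      lemma = solve-∀
      ρ≡0 : ρ ≡ 0ℤ
      ρ≡0 = trans (cong (λ a → swaps (K D A) (K D B) (K D C) a (σ B) (σ C)) σA≡σB)
        (trans (cong (λ b → swaps (K D A) (K D B) (K D C) b b (σ C)) σB≡σC)
               (lemma (K D A) (K D B) (K D C) (σ C)))

    module _ (φ : ℤ → ℤ) (φ-odd : ∀ n → φ (- n) ≡ - φ n) where
      open Invariant φ φ-odd

      U-move₃ : U K σ W₁ ≡ U K σ W₂
      U-move₃ = trans (∑-cong (λ D → cong (λ n → σ D * φ n) (index-move₃ D)) W₁)
        (∑-swap h x A B (∑-swap h y A C (∑-swap h z B C refl)))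
        where h = contribution K σ W₂

-- Letters as positions, Kronecker deltas and counts

∑-zero-local : {φ : X → ℤ} {l : List X} → All (λ x → φ x ≡ 0ℤ) l → ∑ φ l ≡ 0ℤ
∑-zero-local []       = refl
∑-zero-local (p ∷ ps) = cong₂ _+_ p (∑-zero-local ps)

-- A letter is recovered from a position at which it occurs, and positions can be compared. Here
-- `first` is the occurrence that `twice` numbers 0, not necessarily the leftmost one.
letter-≟ : {w : List X} → EachTwice w → DecidableEquality X
letter-≟ {w = w} twice = via-injection (mk↣ {to = λ A → Any.index (first A)} injective) Fin._≟_
  where
  first : ∀ A → A ∈ w
  first A = Inverse.from (twice A) 0F
  injective : ∀ {A B} → Any.index (first A) ≡ Any.index (first B) → A ≡ B
  injective {A} {B} eq = trans (lookup-index (first A))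
    (trans (cong (lookup w) eq) (sym (lookup-index (first B))))

module Indicator {X : Set} (_≟_ : DecidableEquality X) where

  count₁ : X → X → ℕ
  count₁ A B = if does (A ≟ B) then 1 else 0

  K : X → X → ℤ
  K A B = + count₁ A B

  K-≡ : ∀ {A B} → A ≡ B → K A B ≡ 1ℤ
  K-≡ {A} {B} eq = cong (λ b → + (if b then 1 else 0)) (dec-true (A ≟ B) eq)

  K-≢ : ∀ {A B} → A ≢ B → K A B ≡ 0ℤ
  K-≢ {A} {B} neq = cong (λ b → + (if b then 1 else 0)) (dec-false (A ≟ B) neq)

  count : X → List X → ℕ
  count A []      = 0
  count A (B ∷ w) = count₁ A B ℕ.+ count A w

  ∑-count : ∀ A w → ∑ (K A) w ≡ + count A w
  ∑-count A []      = refl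
  ∑-count A (B ∷ w) = cong (_+_ (K A B)) (∑-count A w)

  ∈↔Fin-count : ∀ A w → (A ∈ w) ↔ Fin (count A w)
  ∈↔Fin-count A []      = mk↔ₛ′ (λ ()) (λ ()) (λ ()) (λ ())
  ∈↔Fin-count A (B ∷ w) = ↔-trans (↔-sym (∷↔ (A ≡_)))
    (↔-trans (≡↔Fin ⊎-cong ∈↔Fin-count A w) (↔-sym Fin.+↔⊎))
    where
    ≡↔Fin : (A ≡ B) ↔ Fin (count₁ A B)
    ≡↔Fin with A ≟ B
    ... | yes eq = mk↔ₛ′ (const zero) (const eq) (λ { zero → refl ; (suc ()) }) (λ _ → ≡-irrelevant _ _)
    ... | no neq = mk↔ₛ′ (λ eq → contradiction eq neq) (λ ()) (λ ()) (λ eq → contradiction eq neq)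

  -- Positions of `A` are in bijection with two finite sets, whose sizes must agree. This turns
  -- `EachTwice` into an equation between integers.
  ∑-∈↔Fin : ∀ {A w n} → (A ∈ w) ↔ Fin n → ∑ (K A) w ≡ + n
  ∑-∈↔Fin {A} {w} eq = trans (∑-count A w) (cong +_ (↔⇒≡ (↔-trans (↔-sym (∈↔Fin-count A w)) eq)))

  K-weighted-sym : (σ : X → ℤ) → ∀ A B → σ A * K A B ≡ σ B * K B A
  K-weighted-sym σ A B with A ≟ B
  ... | yes refl = cong (_*_ (σ A)) (sym (K-≡ refl))
  ... | no neq   = trans (ℤ.*-zeroʳ (σ A)) (sym (trans (cong (_*_ (σ B)) (K-≢ (neq ∘ sym))) (ℤ.*-zeroʳ (σ B))))

  -- The six displayed positions already account for both occurrences of `D`, so its counts in the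
  -- four other words have sum 0; being natural numbers, they all vanish.
  absent : ∀ x y z t A B C D →
           K D A + K D B + (K D A + K D C) + (K D B + K D C) ≡ + 2 →
           ∑ (K D) (word₃ x y z t A B A C B C) ≡ + 2 → Absent K x y z t D
  absent x y z t A B C D twice total = record
    { ∉x = zero-count x (ℕ.m+n≡0⇒m≡0 a rest)
    ; ∉y = zero-count y (ℕ.m+n≡0⇒m≡0 b rest₂)
    ; ∉z = zero-count z (ℕ.m+n≡0⇒m≡0 c rest₃)
    ; ∉t = zero-count t (ℕ.m+n≡0⇒n≡0 c rest₃)
    }
    where
    open ≡-Reasoning
    a = count D x
    b = count D y
    c = count D z
    d = count D t
    zero-count : ∀ w → count D w ≡ 0 → ∑ (K D) w ≡ 0ℤ
    zero-count w eq = trans (∑-count D w) (cong +_ eq)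
    lemma₁ : ∀ x y z t k l m →
      x + (k + (l + (y + (k + (m + (z + (l + (m + t)))))))) ≡
      (x + (y + (z + t))) + (k + l + (k + m) + (l + m))
    lemma₁ = solve-∀
    lemma₂ : ∀ s → s ≡ s + + 2 - + 2
    lemma₂ = solve-∀
    expand : ∑ (K D) (word₃ x y z t A B A C B C) ≡
      + a + (K D A + (K D B + (+ b + (K D A + (K D C + (+ c + (K D B + (K D C + + d))))))))
    expand = trans (∑-++ (K D) x _) (cong₂ (λ s r → s + (K D A + (K D B + r))) (∑-count D x)
      (trans (∑-++ (K D) y _) (cong₂ (λ s r → s + (K D A + (K D C + r))) (∑-count D y)
        (trans (∑-++ (K D) z _) (cong₂ (λ s r → s + (K D B + (K D C + r))) (∑-count D z)
          (∑-count D t))))))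
    sum≡0 : + (a ℕ.+ (b ℕ.+ (c ℕ.+ d))) ≡ 0ℤ
    sum≡0 = begin
      + a + (+ b + (+ c + + d))
        ≡⟨ lemma₂ (+ a + (+ b + (+ c + + d))) ⟩
      + a + (+ b + (+ c + + d)) + + 2 - + 2
        ≡⟨ cong (λ s → + a + (+ b + (+ c + + d)) + s - + 2) twice ⟨
      + a + (+ b + (+ c + + d)) + (K D A + K D B + (K D A + K D C) + (K D B + K D C)) - + 2
        ≡⟨ cong (_- + 2) (trans expand (lemma₁ (+ a) (+ b) (+ c) (+ d) (K D A) (K D B) (K D C))) ⟨
      ∑ (K D) (word₃ x y z t A B A C B C) - + 2
        ≡⟨ cong (_- + 2) total ⟩
      0ℤ ∎
    rest : a ℕ.+ (b ℕ.+ (c ℕ.+ d)) ≡ 0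
    rest = ℤ.+-injective sum≡0
    rest₂ : b ℕ.+ (c ℕ.+ d) ≡ 0
    rest₂ = ℕ.m+n≡0⇒n≡0 a rest
    rest₃ : c ℕ.+ d ≡ 0
    rest₃ = ℕ.m+n≡0⇒n≡0 b rest₂

-- The words A B₁⋯Bₖ A Bₖ⋯B₁

nest : X → (V → X) → List V → List X
nest A g b = A ∷ map g b ++ A ∷ reverse (map g b)

module _ {X V : Set} (K : X → X → ℤ) (A : X) (g : V → X) (b : List V)
         (K-AA : K A A ≡ 1ℤ) (K-Ag : ∀ B → K A (g B) ≡ 0ℤ) (K-gA : ∀ B → K (g B) A ≡ 0ℤ)
         (once : ∀ B → ∑ (K (g B) ∘ g) b ≡ 1ℤ)
         (distinct : AllPairs (λ B C → K (g B) (g C) ≡ 0ℤ × K (g C) (g B) ≡ 0ℤ) b) where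

  private
    S : List X
    S = map g b

    ±S : ℤ → List (X × ℤ)
    ±S δ = map (λ B → g B , δ) b

    σ : X → ℤ
    σ = const 1ℤ

    κ = + length b

  private
    -- Distinct letters do not see each other, so each is annotated by the context alone.
    scan-S : ∀ {c δ l} → All (λ B → c (g B) ≡ δ) l →
             AllPairs (λ B C → K (g B) (g C) ≡ 0ℤ × K (g C) (g B) ≡ 0ℤ) l →
             scan K c (map g l) ≡ map (λ B → g B , δ) l
    scan-S                      []       []           = refl
    scan-S {c} {δ} {B ∷ l} (refl ∷ eqs) (ps ∷ pairs) = cong₂ _∷_
      (cong (g B ,_) (trans (cong (_-_ (c (g B)))
        (trans (∑-map (K (g B)) g l) (∑-zero-local (All.map proj₁ ps)))) (ℤ.+-identityʳ _)))
      (scan-S (All.zipWith (λ (p , q) → trans (cong₂ _+_ p (proj₂ q)) (ℤ.+-identityʳ δ)) (eqs , ps)) pairs)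

    ∑-K-A : ∑ (K A) S ≡ 0ℤ
    ∑-K-A = trans (∑-map (K A) g b) (∑-zero K-Ag b)

    ∑-K-g : ∀ B → ∑ (K (g B)) S ≡ 1ℤ
    ∑-K-g B = trans (∑-map (K (g B)) g b) (once B)

    flags-nest : flags K (nest A g b) ≡ (A , -1ℤ) ∷ ±S -1ℤ ++ (A , 1ℤ) ∷ reverse (±S 1ℤ)
    flags-nest = cong₂ _∷_
      (cong (λ s → A , 0ℤ - s) (trans (∑-++ (K A) S (A ∷ reverse S))
        (cong₂ _+_ ∑-K-A (cong₂ _+_ K-AA (trans (∑-reverse (K A) S) ∑-K-A)))))
      (trans (scan-++ K (λ z → 0ℤ + K z A) S (A ∷ reverse S)) (cong₂ _++_
        (scan-S (All.universal (λ B → cong₂ (λ p q → 0ℤ + p - q) (K-gA B)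
          (cong₂ _+_ (K-gA B) (trans (∑-reverse (K (g B)) S) (∑-K-g B)))) b) distinct)
        (cong₂ _∷_
          (cong (A ,_) (trans (cong₂ (λ p q → 0ℤ + p + q - ∑ (K A) (reverse S)) K-AA ∑-K-A)
            (cong (_-_ 1ℤ) (trans (∑-reverse (K A) S) ∑-K-A))))
          (trans (scan-reverse K (λ z → 0ℤ + K z A + ∑ (K z) S + K z A) S)
            (cong reverse (trans (cong (map negate)
              (scan-S (All.universal (λ B → cong -_
                (cong₂ _+_ (cong₂ (λ p q → 0ℤ + p + q) (K-gA B) (∑-K-g B)) (K-gA B))) b) distinct))
              (sym (map-∘ b))))))))

    ∑-weight-±S : ∀ δ → ∑ (weight σ) (±S δ) ≡ κ * δ
    ∑-weight-±S δ = helper b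
      where
      lemma : ∀ n δ → 1ℤ * δ + n * δ ≡ (1ℤ + n) * δ
      lemma = solve-∀
      helper : ∀ l → ∑ (weight σ) (map (λ B → g B , δ) l) ≡ + length l * δ
      helper []      = sym (ℤ.*-zeroˡ δ)
      helper (B ∷ l) = trans (cong (_+_ (1ℤ * δ)) (helper l)) (lemma (+ length l) δ)

    K₂ : X × ℤ → X × ℤ → ℤ
    K₂ _ = weight σ

    -- A term is linear in the level, so raising all levels by `d` adds `d` times the signed count
    -- of `e`.
    ∑-term-shift : ∀ e {c c′ : X × ℤ → ℤ} {d} → (∀ p → c p ≡ c′ p + d) → ∀ l →
      ∑ (term K e) (scan K₂ c l) ≡ ∑ (term K e) (scan K₂ c′ l) + ∑ (λ (B , δ) → K e B * δ) l * d
    ∑-term-shift e         {d = d} eq []            = sym (trans (ℤ.+-identityˡ _) (ℤ.*-zeroˡ d))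
    ∑-term-shift e {c} {c′} {d} eq ((B , δ) ∷ l) = begin
      K e B * (δ * (c (B , δ) - ∑ (weight σ) l)) + ∑ (term K e) (scan K₂ (λ p → c p + 1ℤ * δ) l)
        ≡⟨ cong₂ (λ p q → K e B * (δ * (p - ∑ (weight σ) l)) + q) (eq (B , δ))
             (∑-term-shift e (λ p → trans (cong (_+ 1ℤ * δ) (eq p)) (lemma₁ (c′ p) d (1ℤ * δ))) l) ⟩
      K e B * (δ * (c′ (B , δ) + d - ∑ (weight σ) l)) +
      (∑ (term K e) (scan K₂ (λ p → c′ p + 1ℤ * δ) l) + ∑ (λ (B , δ) → K e B * δ) l * d)
        ≡⟨ lemma₂ (K e B) δ (c′ (B , δ)) d (∑ (weight σ) l) _ (∑ (λ (B , δ) → K e B * δ) l) ⟩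
      K e B * (δ * (c′ (B , δ) - ∑ (weight σ) l)) +
      ∑ (term K e) (scan K₂ (λ p → c′ p + 1ℤ * δ) l) + (K e B * δ + ∑ (λ (B , δ) → K e B * δ) l) * d ∎
      where
      open ≡-Reasoning
      lemma₁ : ∀ a b c → a + b + c ≡ a + c + b
      lemma₁ = solve-∀
      lemma₂ : ∀ k δ c d w t s → k * (δ * (c + d - w)) + (t + s * d) ≡
               k * (δ * (c - w)) + t + (k * δ + s) * d
      lemma₂ = solve-∀

    -- The second half of the word mirrors the first, so its terms are those of
    -- the first half over a different base level.
    ∑-term-mirror : ∀ e d → ∑ (term K e) (scan K₂ (const d) (reverse (±S 1ℤ))) ≡
                    - ∑ (term K e) (scan K₂ (const d) (±S -1ℤ))
    ∑-term-mirror e d = begin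
      ∑ t (scan K₂ (const d) (reverse (±S 1ℤ)))
        ≡⟨ cong (∑ t) (scan-reverse K₂ (const d) (±S 1ℤ)) ⟩
      ∑ t (reverse (map negate (scan K₂ (const (- d)) (±S 1ℤ))))
        ≡⟨ trans (∑-reverse t (map negate (scan K₂ (const (- d)) (±S 1ℤ))))
                 (∑-map t negate (scan K₂ (const (- d)) (±S 1ℤ))) ⟩
      ∑ (t ∘ negate) (scan K₂ (const (- d)) (±S 1ℤ))
        ≡⟨ cong (∑ (t ∘ negate)) (trans (cong (scan K₂ (const (- d))) (map-∘ b))
             (scan-map-scaled negate (const -1ℤ) K₂ K₂
             (±S -1ℤ) (All.universal (λ _ → sym (ℤ.-1*i≡-i d)) (±S -1ℤ))
             (allPairs (λ (_ , δ) (_ , δ′) → lemma₁ δ′ , lemma₁ δ) (±S -1ℤ)))) ⟩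
      ∑ (t ∘ negate) (map (λ (p , D) → negate p , -1ℤ * D) (scan K₂ (const d) (±S -1ℤ)))
        ≡⟨ ∑-map (t ∘ negate) _ (scan K₂ (const d) (±S -1ℤ)) ⟩
      ∑ (λ ((B , δ) , D) → K e B * (- δ * - (-1ℤ * D))) (scan K₂ (const d) (±S -1ℤ))
        ≡⟨ ∑-cong (λ ((B , δ) , D) → lemma₂ (K e B) δ D) (scan K₂ (const d) (±S -1ℤ)) ⟩
      ∑ (-_ ∘ t) (scan K₂ (const d) (±S -1ℤ))
        ≡⟨ ∑-neg t (scan K₂ (const d) (±S -1ℤ)) ⟩
      - ∑ t (scan K₂ (const d) (±S -1ℤ)) ∎
      where
      open ≡-Reasoning
      t = term K e
      lemma₁ : ∀ a → 1ℤ * - a ≡ -1ℤ * (1ℤ * a)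
      lemma₁ = solve-∀
      lemma₂ : ∀ k δ d → k * (- δ * - (-1ℤ * d)) ≡ - (k * (δ * d))
      lemma₂ = solve-∀

  -- Between the two occurrences of `A` lie the first occurrences of all `Bᵢ`, of weight -1 each.
  -- Between those of `Bᵢ` the inner letters cancel and the second `A` contributes 1. Doubling gives
  -- -2κ and 2.
  index-nest : ∀ e → index K σ (nest A g b) e ≡ + 2 * ∑ (K e) S - + 2 * κ * K e A
  index-nest e = begin
    ∑ t (levels σ (flags K (nest A g b)))
      ≡⟨ cong (∑ t ∘ levels σ) flags-nest ⟩
    K e A * (-1ℤ * (0ℤ - w (±S -1ℤ ++ (A , 1ℤ) ∷ R))) +
    ∑ t (scan K₂ (const (-1ℤ)) (±S -1ℤ ++ (A , 1ℤ) ∷ R))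
      ≡⟨ cong₂ (λ p q → K e A * (-1ℤ * (0ℤ - p)) + q)
           (∑-++ (weight σ) (±S -1ℤ) ((A , 1ℤ) ∷ R))
           (trans (cong (∑ t) (scan-++ K₂ (const -1ℤ) (±S -1ℤ) ((A , 1ℤ) ∷ R)))
                  (∑-++ t (scan K₂ (const (-1ℤ - (1ℤ + w R))) (±S -1ℤ)) _)) ⟩
    K e A * (-1ℤ * (0ℤ - (w (±S -1ℤ) + (1ℤ + w R)))) +
    (T (-1ℤ - (1ℤ + w R)) +
     (K e A * (1ℤ * (-1ℤ + w (±S -1ℤ) - w R)) + ∑ t (scan K₂ (const (-1ℤ + w (±S -1ℤ) + 1ℤ)) R)))
      ≡⟨ cong₂ (λ p q → K e A * (-1ℤ * (0ℤ - (p + (1ℤ + q)))) +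
           (T (-1ℤ - (1ℤ + q)) + (K e A * (1ℤ * (-1ℤ + p - q)) + ∑ t (scan K₂ (const (-1ℤ + p + 1ℤ)) R))))
           (∑-weight-±S -1ℤ) (trans (∑-reverse (weight σ) (±S 1ℤ)) (∑-weight-±S 1ℤ)) ⟩
    K e A * (-1ℤ * (0ℤ - (κ * -1ℤ + (1ℤ + κ * 1ℤ)))) +
    (T d₁ + (K e A * (1ℤ * (-1ℤ + κ * -1ℤ - κ * 1ℤ)) + ∑ t (scan K₂ (const d₂) R)))
      ≡⟨ cong₂ (λ p q → K e A * (-1ℤ * (0ℤ - (κ * -1ℤ + (1ℤ + κ * 1ℤ)))) +
           (p + (K e A * (1ℤ * (-1ℤ + κ * -1ℤ - κ * 1ℤ)) + q)))
           (trans (∑-term-shift e (λ _ → lemma₁ d₁ d₂) (±S -1ℤ))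
                  (cong (λ s → T d₂ + s * (d₁ - d₂)) (∑-K-±S b)))
           (∑-term-mirror e d₂) ⟩
    K e A * (-1ℤ * (0ℤ - (κ * -1ℤ + (1ℤ + κ * 1ℤ)))) +
    (T d₂ + (- ∑ (K e) S) * (d₁ - d₂) + (K e A * (1ℤ * (-1ℤ + κ * -1ℤ - κ * 1ℤ)) + - T d₂))
      ≡⟨ lemma₂ (K e A) κ (T d₂) (∑ (K e) S) ⟩
    + 2 * ∑ (K e) S - + 2 * κ * K e A ∎
    where
    open ≡-Reasoning
    t = term K e
    w = ∑ (weight σ)
    R = reverse (±S 1ℤ)
    -- `d₁` and `d₂` are the base levels of the two copies of `b`. Over a common base the copies
    -- cancel by `∑-term-mirror`, so only the difference `d₁ - d₂`, which is -2, leaves a trace.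
    d₁ = -1ℤ - (1ℤ + κ * 1ℤ)
    d₂ = -1ℤ + κ * -1ℤ + 1ℤ
    T : ℤ → ℤ
    T d = ∑ t (scan K₂ (const d) (±S -1ℤ))
    ∑-K-±S : ∀ l → ∑ (λ (B , δ) → K e B * δ) (map (λ B → g B , -1ℤ) l) ≡ - ∑ (K e) (map g l)
    ∑-K-±S []      = refl
    ∑-K-±S (B ∷ l) = trans (cong₂ _+_ (lemma₃ (K e (g B))) (∑-K-±S l))
                           (sym (ℤ.neg-distrib-+ (K e (g B)) _))
      where
      lemma₃ : ∀ a → a * -1ℤ ≡ - a
      lemma₃ = solve-∀
    lemma₁ : ∀ a b → a ≡ b + (a - b)
    lemma₁ = solve-∀
    lemma₂ : ∀ k n T s →
      k * (-1ℤ * (0ℤ - (n * -1ℤ + (1ℤ + n * 1ℤ)))) +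
      (T + (- s) * (-1ℤ - (1ℤ + n * 1ℤ) - (-1ℤ + n * -1ℤ + 1ℤ)) +
       (k * (1ℤ * (-1ℤ + n * -1ℤ - n * 1ℤ)) + - T)) ≡
      + 2 * s - + 2 * n * k
    lemma₂ = solve-∀

-- Nanowords

at : ∀ {B : X} (vs : Vec (List X) k) r → B ∈ Vec.lookup vs r → VecAny (B ∈_) vs
at (v ∷ vs) zero    p = here p
at (v ∷ vs) (suc r) p = there (at vs r p)

index-at : ∀ {B : X} (vs : Vec (List X) k) r (p : B ∈ Vec.lookup vs r) → VecAny.index (at vs r p) ≡ r
index-at (v ∷ vs) zero    p = refl
index-at (v ∷ vs) (suc r) p = cong suc (index-at vs r p)

at-injective : ∀ {B : X} (vs : Vec (List X) k) r {p q : B ∈ Vec.lookup vs r} → at vs r p ≡ at vs r q → p ≡ q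
at-injective (v ∷ vs) zero    refl = refl
at-injective (v ∷ vs) (suc r) eq   = at-injective vs r (there-injective eq)
  where
  there-injective : ∀ {P : List _ → Set} {x} {xs : Vec _ _} {p q : VecAny P xs} →
                    _≡_ {A = VecAny P (x ∷ xs)} (there p) (there q) → p ≡ q
  there-injective refl = refl

∈-concat : ∀ {B : X} {vs : Vec (List X) k} → VecAny (B ∈_) vs → B ∈ concat (Vec.toList vs)
∈-concat (here p)          = ∈-++⁺ˡ p
∈-concat (there {x = v} p) = ∈-++⁺ʳ v (∈-concat p)

allPairs-lookup⁻ : {R : X → X → Set} (xs : Vec X k) →
                   (∀ i j → i ≢ j → R (Vec.lookup xs i) (Vec.lookup xs j)) → VecAllPairs R xs
allPairs-lookup⁻ []       r = []
allPairs-lookup⁻ (x ∷ xs) r =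
  lookup⁻ (λ j → r zero (suc j) λ ()) ∷
  allPairs-lookup⁻ xs (λ i j i≢j → r (suc i) (suc j) (i≢j ∘ Fin.suc-injective))

-- Membership proofs stand for positions. The condition on `eq` makes `p` and `q` different
-- positions even if they carry the same letter.
allPairs-positions : {R : X → X → Set} (l : List X) →
  (∀ {x y} (p : x ∈ l) (q : y ∈ l) → (∀ eq → subst (_∈ l) eq p ≢ q) → R x y) → AllPairs R l
allPairs-positions []      r = []
allPairs-positions (x ∷ l) r =
  All.tabulate (λ q → r (here refl) (there q) (λ { refl () })) ∷
  allPairs-positions l (λ p q p≢q → r (there p) (there q) (λ { refl eq → p≢q refl (there-injective eq) }))
  where
  there-injective : ∀ {y z} {l : List _} {p q : y ∈ l} → _≡_ {A = y ∈ (z ∷ l)} (there p) (there q) → p ≡ q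
  there-injective refl = refl

module _ {a} {Q : Set a} where

  -- Equations between chosen signs are decidable, but their failure is refuted only in the sense of
  -- `Q`. This is how such equations are assumed for a whole word at once.
  all-or : {P : X → Set} (w : List X) → Decidable P → (∀ A → ¬ P A → Q) →
           ((∀ {A} → A ∈ w → P A) → Q) → Q
  all-or w P? refute use with All.all? P? w
  ... | yes ps = use (All.lookup ps)
  ... | no ¬ps with A , ¬p ← satisfied (¬All⇒Any¬ P? w ¬ps) = refute A ¬p

-- Signs and decorations relative to a fixed point

module Cobordism {a} {α : Set a} (τ : α → α) (τ-involutive : Involutive _≡_ τ) (x₀ : α) where

  open Nanowords τ
  open Alphabet
  open Nanoword
  open _⊆_ using (inclusion; Image)
  open Endo α using (_^_)

  Q : Set a
  Q = τ x₀ ≡ x₀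

  -- An element of Sign x cannot be computed, but may be assumed while proving Q.
  data Sign (x : α) : Set a where
    plus  : x ≡ x₀ → Sign x
    minus : x ≡ τ x₀ → Sign x
    none  : (x ≡ x₀ → Q) → (x ≡ τ x₀ → Q) → Sign x

  sign : ∀ {x} → Sign x → ℤ
  sign (plus _)   = 1ℤ
  sign (minus _)  = -1ℤ
  sign (none _ _) = 0ℤ

  -- Excluded middle under double negation, with `Q` for falsity: the continuation itself provides
  -- both refutations that `none` asks for.
  choose : ∀ x → (Sign x → Q) → Q
  choose x use = use (none (use ∘ plus) (use ∘ minus))

  -- Two different signs of one point either place it at both `x₀` and `τ x₀` or contradict a
  -- `none`, and each case gives `Q`. So up to `Q` the choice of signs is immaterial.
  sign-cong : ∀ {x y} (s : Sign x) (t : Sign y) → x ≡ y → sign s ≢ sign t → Q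
  sign-cong (plus p)   (plus q)   refl neq = contradiction refl neq
  sign-cong (plus p)   (minus q)  refl neq = trans (sym q) p
  sign-cong (plus p)   (none f g) refl neq = f p
  sign-cong (minus p)  (plus q)   refl neq = trans (sym p) q
  sign-cong (minus p)  (minus q)  refl neq = contradiction refl neq
  sign-cong (minus p)  (none f g) refl neq = g p
  sign-cong (none f g) (plus q)   refl neq = f q
  sign-cong (none f g) (minus q)  refl neq = g q
  sign-cong (none f g) (none _ _) refl neq = contradiction refl neq

  sign-τ : ∀ {x y} (s : Sign x) (t : Sign y) → y ≡ τ x → sign t ≢ - sign s → Q
  sign-τ (plus p)   (plus q)   refl neq = trans (sym (cong τ p)) q
  sign-τ (plus p)   (minus q)  refl neq = contradiction refl neq
  sign-τ (plus p)   (none f g) refl neq = g (cong τ p)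
  sign-τ (minus p)  (plus q)   refl neq = contradiction refl neq
  sign-τ (minus p)  (minus q)  refl neq = trans (sym q) (trans (cong τ p) (τ-involutive x₀))
  sign-τ (minus p)  (none f g) refl neq = f (trans (cong τ p) (τ-involutive x₀))
  sign-τ (none f g) (plus q)   refl neq = g (trans (sym (τ-involutive _)) (cong τ q))
  sign-τ (none f g) (minus q)  refl neq =
    f (trans (sym (τ-involutive _)) (trans (cong τ q) (τ-involutive x₀)))
  sign-τ (none f g) (none _ _) refl neq = contradiction refl neq

  Decoration : Nanoword → Set a
  Decoration N = ∀ A → Sign (proj (alphabet N) A)

  sgn : ∀ N → Decoration N → Letter (alphabet N) → ℤ
  sgn N d A = sign (d A)

  occurs : ∀ N A → A ∈ word N
  occurs N A = Inverse.from (twice N A) 0F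

  -- Signs are chosen one at a time along the word; this reaches every letter because every letter
  -- occurs.
  decorate : ∀ N → (Decoration N → Q) → Q
  decorate N use = choose-all (word N) (λ signs → use (λ A → All.lookup signs (occurs N A)))
    where
    choose-all : ∀ w → (All (λ A → Sign (proj (alphabet N) A)) w → Q) → Q
    choose-all []      use = use []
    choose-all (A ∷ w) use = choose _ (λ s → choose-all w (λ signs → use (s ∷ signs)))

  module Kernel (N : Nanoword) = Indicator (letter-≟ (twice N))

  kernel : ∀ N → Letter (alphabet N) → Letter (alphabet N) → ℤ
  kernel = Kernel.K

  kernel-injective : ∀ {N M} {f : Letter (alphabet M) → Letter (alphabet N)} →
    (∀ {A B} → f A ≡ f B → A ≡ B) → ∀ A B → kernel N (f A) (f B) ≡ kernel M A B
  kernel-injective {N} {M} {f} inj A B = by (letter-≟ (twice M) A B)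
    where
    by : Dec (A ≡ B) → kernel N (f A) (f B) ≡ kernel M A B
    by (yes A≡B) = trans (Kernel.K-≡ N (cong f A≡B)) (sym (Kernel.K-≡ M A≡B))
    by (no A≢B)  = trans (Kernel.K-≢ N (A≢B ∘ inj)) (sym (Kernel.K-≢ M A≢B))

  -- Invariance under cobordism

  module Obstruction (φ : ℤ → ℤ) (φ-odd : ∀ n → φ (- n) ≡ - φ n) where

    open Invariant φ φ-odd

    U-cong : {K L : X → X → ℤ} {σ ρ : X → ℤ} → (∀ x y → K x y ≡ L x y) → σ ≗ ρ →
             ∀ w → U K σ w ≡ U L ρ w
    U-cong {K = K} {σ = σ} eq eq′ w = trans (cong (U K σ) (sym (map-id w))) (U-map id eq eq′ w)

    u : ∀ N → Decoration N → ℤ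
    u N d = U (kernel N) (sgn N d) (word N)

    -- "Not different" with Q in place of ⊥.
    infix 4 _≈_
    record _≈_ (N M : Nanoword) : Set a where
      constructor ⟦_⟧
      field
        apply : ∀ d d′ → u N d ≢ u M d′ → Q

    -- The common frame of all moves. By `sign-cong`, `d′` can disagree with the restriction of `d`
    -- only if `Q` holds. The argument `step` has continuation form because the relations between
    -- signs that a move needs hold only up to `Q`.
    restrict : ∀ {N M} (f : Letter (alphabet M) → Letter (alphabet N)) →
      (∀ {A B} → f A ≡ f B → A ≡ B) →
      (∀ A → proj (alphabet N) (f A) ≡ proj (alphabet M) A) →
      (∀ d → (u N d ≡ U (kernel N on f) (sgn N d ∘ f) (word M) → Q) → Q) →
      N ≈ M
    restrict {N} {M} f inj label step = ⟦_⟧ λ d d′ neq → step d λ eq →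
      all-or (word M) (λ A → sign (d (f A)) ℤ.≟ sign (d′ A))
        (λ A → sign-cong (d (f A)) (d′ A) (label A))
        λ same → contradiction
          (trans eq (U-cong (kernel-injective {N} {M} inj) (λ A → same (occurs M A)) (word M))) neq

    ≈-refl : ∀ {N} → N ≈ N
    ≈-refl {N} = restrict id id (λ _ → refl) (λ d use → use refl)

    ≈-sym : ∀ {N M} → N ≈ M → M ≈ N
    ≈-sym ⟦ N≈M ⟧ = ⟦_⟧ λ d d′ neq → N≈M d′ d (neq ∘ sym)

    ≈-trans : ∀ {N M L} → N ≈ M → M ≈ L → N ≈ L
    -- Neither `d` nor `d″` gives signs to the letters of `M`, so a decoration of it is chosen.
    ≈-trans {N} {M} {L} ⟦ N≈M ⟧ ⟦ M≈L ⟧ = ⟦_⟧ λ d d″ neq → decorate M λ d′ → by d d″ neq d′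
      where
      by : ∀ d d″ → u N d ≢ u L d″ → Decoration M → Q
      by d d″ neq d′ with u N d ℤ.≟ u M d′
      ... | no N≢M  = N≈M d d′ N≢M
      ... | yes N≡M = M≈L d′ d″ (neq ∘ trans N≡M)

    ≈-isEquivalence : IsEquivalence _≈_
    ≈-isEquivalence = record
      { refl  = ≈-refl
      ; sym   = ≈-sym
      ; trans = ≈-trans
      }

    value-injective : ∀ {P : Pred X 0ℓ} {A B : Refinement X P} → value A ≡ value B → A ≡ B
    value-injective refl = refl

    ≈-iso : ∀ {N M} → N ≅ M → N ≈ M
    ≈-iso {N} {M} (isomorphism f label image) = ≈-sym
      (restrict to (Injection.injective (↔⇒↣ f)) label
        (λ d use → use (trans (cong (U (kernel M) (sgn M d)) (sym image))
                              (U-map to {σ = sgn M d} (λ _ _ → refl) (λ _ → refl) (word N)))))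
      where open Inverse f

    -- Treated as a surgery with the single word `AA`, the identity as `ι` and `e` equal to 1.
    ≈-move₁ : ∀ {𝒜} A (x y : List (Letter (𝒜 ∖ (A ≡_)))) {p q} →
      nanoword 𝒜 (map value x ++ A ∷ A ∷ map value y) p ≈ nanoword (𝒜 ∖ (A ≡_)) (x ++ y) q
    ≈-move₁ {𝒜} A x y {p} {q} = restrict {N} value value-injective (λ _ → refl) λ d use → use (trans
      (U-interleave value (const A) (kernel N) (sgn N d) id (const 1ℤ) (λ _ → inj₁ refl)
        (λ (z , Irrelevant.[ A≢z ]) _ → K-≢ λ eq → contradiction-irr A≢z (λ A≢z → A≢z (sym eq)))
        (λ (z , Irrelevant.[ A≢z ]) _ → K-≢ λ eq → contradiction-irr A≢z (λ A≢z → A≢z eq))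
        (λ _ _ → refl) (λ _ _ → ℤ.*-comm (kernel N A A) 1ℤ) (λ _ → sym (ℤ.*-identityˡ (sgn N d A)))
        (x ∷ y ∷ []) {(tt ∷ tt ∷ []) ∷ []}
        ([] ∷ []) (allPairs (λ _ _ → sym (ℤ.*-identityˡ _) , sym (ℤ.*-identityˡ _)) _ ∷ []) (refl ∷ []))
      (cong (λ w → U (kernel N on value) (sgn N d ∘ value) (x ++ w)) (++-identityʳ y)))
      where
      N = nanoword 𝒜 (map value x ++ A ∷ A ∷ map value y) p
      open Kernel N

    -- Treated as a surgery with the words `AB` and `BA`: `ι` exchanges the letters, which are
    -- indexed by `Bool`, and `e` is -1. The condition on labels makes their signs opposite, up to
    -- `Q`.
    ≈-move₂ : ∀ {𝒜} A B (x y z : List (Letter (𝒜 ∖ (λ C → A ≡ C ⊎ B ≡ C)))) {p q} →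
      proj 𝒜 B ≡ τ (proj 𝒜 A) →
      nanoword 𝒜 (map value x ++ A ∷ B ∷ map value y ++ B ∷ A ∷ map value z) p
        ≈ nanoword (𝒜 ∖ (λ C → A ≡ C ⊎ B ≡ C)) (x ++ y ++ z) q
    ≈-move₂ {𝒜} A B x y z {p} {q} ∣B∣≡τ∣A∣ = restrict {N} value value-injective (λ _ → refl) step
      where
      W = map value x ++ A ∷ B ∷ map value y ++ B ∷ A ∷ map value z
      N = nanoword 𝒜 W p
      open Kernel N

      g : Bool → Letter 𝒜
      g true  = A
      g false = B

      xs = x ∷ y ∷ z ∷ []
      vs = (true ∷ false ∷ []) ∷ (false ∷ true ∷ []) ∷ []

      value≢g : ∀ z b → value {P = λ _ → _} z ≢ g b
      value≢g (z , Irrelevant.[ z∉ ]) true  eq = contradiction-irr z∉ (λ z∉ → z∉ (inj₁ (sym eq)))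
      value≢g (z , Irrelevant.[ z∉ ]) false eq = contradiction-irr z∉ (λ z∉ → z∉ (inj₂ (sym eq)))

      -- Otherwise one letter would occur at all four displayed positions.
      A≢B : A ≢ B
      A≢B A≡B = four≢two (trans (sym (trans (∑-interleave value g (K A) xs vs)
          (cong₂ _+_ (∑-zero (λ z → K-≢ (value≢g z true ∘ sym)) (concat (Vec.toList xs)))
            (cong₂ _+_ (K-≡ refl) (cong₂ _+_ (K-≡ A≡B) (cong₂ _+_ (K-≡ A≡B) (cong (_+ 0ℤ) (K-≡ refl))))))))
        (∑-∈↔Fin (p A)))
        where
        four≢two : + 4 ≢ + 2
        four≢two ()

      K-g-not : ∀ b → K (g b) (g (not b)) ≡ 0ℤ
      K-g-not true  = K-≢ A≢B
      K-g-not false = K-≢ (A≢B ∘ sym)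

      K-g-≡ : ∀ b → K (g b) (g b) ≡ 1ℤ
      K-g-≡ b = K-≡ refl

      K-not : ∀ b c → K (g (not b)) (g (not c)) ≡ K (g b) (g c)
      K-not true  true  = trans (K-g-≡ false) (sym (K-g-≡ true))
      K-not true  false = trans (K-g-not false) (sym (K-g-not true))
      K-not false true  = trans (K-g-not true) (sym (K-g-not false))
      K-not false false = trans (K-g-≡ true) (sym (K-g-≡ false))

      total-tf : ∀ b → ∑ (K (g b) ∘ g) (true ∷ false ∷ []) ≡ 1ℤ
      total-tf true  = cong₂ _+_ (K-g-≡ true) (cong (_+ 0ℤ) (K-g-not true))
      total-tf false = cong₂ _+_ (K-g-not false) (cong (_+ 0ℤ) (K-g-≡ false))

      total-ft : ∀ b → ∑ (K (g b) ∘ g) (false ∷ true ∷ []) ≡ 1ℤ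
      total-ft true  = cong₂ _+_ (K-g-not true) (cong (_+ 0ℤ) (K-g-≡ true))
      total-ft false = cong₂ _+_ (K-g-≡ false) (cong (_+ 0ℤ) (K-g-not false))

      constant : ∀ {ψ : Bool → ℤ} → (∀ b → ψ b ≡ 1ℤ) → ∀ b → Anti not (const -1ℤ) ψ b
      constant eq b = ⟪ trans (eq (not b)) (sym (cong (λ n → - (-1ℤ * n)) (eq b))) ⟫

      compatible : ∀ b c → b ≢ c → Compatible not (const -1ℤ) (K on g) (K on g) b c
      compatible true  true  b≢c = contradiction refl b≢c
      compatible true  false _   = trans (K-g-not false) (sym (cong (_*_ -1ℤ) (K-g-not true))) ,
                                   trans (K-g-not true) (sym (cong (_*_ -1ℤ) (K-g-not false)))
      compatible false true  _   = trans (K-g-not true) (sym (cong (_*_ -1ℤ) (K-g-not false))) ,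
                                   trans (K-g-not false) (sym (cong (_*_ -1ℤ) (K-g-not true)))
      compatible false false b≢c = contradiction refl b≢c

      step : ∀ d → (u N d ≡ U (kernel N on value) (sgn N d ∘ value) (x ++ y ++ z) → Q) → Q
      step d use with sgn N d B ℤ.≟ - sgn N d A
      ... | no neq = sign-τ (d A) (d B) ∣B∣≡τ∣A∣ neq
      ... | yes eq = use (trans
        (U-interleave value g K (sgn N d) not (const -1ℤ) (λ _ → inj₂ refl)
          (λ z b → K-≢ (value≢g z b)) (λ z b → K-≢ (value≢g z b ∘ sym))
          K-not (λ b c → ℤ.*-comm (K (g b) (g c)) -1ℤ) σ-not xs {vs}
          (((All.universal (constant total-ft) _ , All.universal (constant total-tf) _) ∷ []) ∷ [] ∷ [])
          (((compatible true false (λ ()) ∷ []) ∷ [] ∷ []) ∷ ((compatible false true (λ ()) ∷ []) ∷ [] ∷ []) ∷ [])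
          (refl ∷ refl ∷ []))
        (cong (λ w → U (kernel N on value) (sgn N d ∘ value) (x ++ y ++ w)) (++-identityʳ z)))
        where
        σ-not : ∀ b → sgn N d (g (not b)) ≡ -1ℤ * sgn N d (g b)
        σ-not true  = trans eq (sym (ℤ.-1*i≡-i (sgn N d A)))
        σ-not false = trans (sym (ℤ.neg-involutive (sgn N d A)))
          (trans (cong -_ (sym eq)) (sym (ℤ.-1*i≡-i (sgn N d B))))

    ≈-move₃ : ∀ {𝒜} A B C (x y z t : List (Letter 𝒜)) {p q} →
      A ≢ B → A ≢ C → B ≢ C → proj 𝒜 A ≡ proj 𝒜 B → proj 𝒜 B ≡ proj 𝒜 C →
      nanoword 𝒜 (x ++ A ∷ B ∷ y ++ A ∷ C ∷ z ++ B ∷ C ∷ t) p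
        ≈ nanoword 𝒜 (x ++ B ∷ A ∷ y ++ C ∷ A ∷ z ++ C ∷ B ∷ t) q
    ≈-move₃ {𝒜} A B C x y z t {p} {q} A≢B A≢C B≢C ∣A∣≡∣B∣ ∣B∣≡∣C∣ =
      restrict {N} id id (λ _ → refl) step
      where
      N = nanoword 𝒜 (word₃ x y z t A B A C B C) p
      open Kernel N

      step : ∀ d → (u N d ≡ U (kernel N) (sgn N d) (word₃ x y z t B A C A C B) → Q) → Q
      step d use with sgn N d A ℤ.≟ sgn N d B | sgn N d B ℤ.≟ sgn N d C
      ... | no neq | _       = sign-cong (d A) (d B) ∣A∣≡∣B∣ neq
      ... | yes _  | no neq  = sign-cong (d B) (d C) ∣B∣≡∣C∣ neq
      ... | yes eq | yes eq′ = use (U-move₃ K {x} {y} {z} {t} AA BB CC AB BA AC CA BC CB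
        (absent x y z t A B C A (cong₂ _+_ (cong₂ _+_ (cong₂ _+_ AA AB) (cong₂ _+_ AA AC)) (cong₂ _+_ AB AC))
          (∑-∈↔Fin (p A)))
        (absent x y z t A B C B (cong₂ _+_ (cong₂ _+_ (cong₂ _+_ BA BB) (cong₂ _+_ BA BC)) (cong₂ _+_ BB BC))
          (∑-∈↔Fin (p B)))
        (absent x y z t A B C C (cong₂ _+_ (cong₂ _+_ (cong₂ _+_ CA CB) (cong₂ _+_ CA CC)) (cong₂ _+_ CB CC))
          (∑-∈↔Fin (p C)))
        (sgn N d) eq eq′ φ φ-odd)
        where
        AA = K-≡ {A} refl
        BB = K-≡ {B} refl
        CC = K-≡ {C} refl
        AB = K-≢ A≢B
        BA = K-≢ (A≢B ∘ sym)
        AC = K-≢ A≢C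
        CA = K-≢ (A≢C ∘ sym)
        BC = K-≢ B≢C
        CB = K-≢ (B≢C ∘ sym)

    ≈-surgery : ∀ {𝒜} (∇ : Nanophrase) → Nanophrase.Symmetric ∇ → (ℬ⊆𝒜 : Nanophrase.alphabet ∇ ⊆ 𝒜)
      (xs : Vec (List (Letter (𝒜 ∖ Image ℬ⊆𝒜))) (suc (Nanophrase.size ∇))) {p : EachTwice _} {q : EachTwice _} →
      nanoword 𝒜 (interleave value (inclusion ℬ⊆𝒜) xs (Nanophrase.words ∇)) p
        ≈ nanoword (𝒜 ∖ Image ℬ⊆𝒜) (concat (Vec.toList xs)) q
    ≈-surgery {𝒜} ∇ symmetric ℬ⊆𝒜 xs {p} {q} = restrict {N} value value-injective (λ _ → refl) step
      where
      open Nanophrase ∇ renaming (alphabet to ℬ; words to vs; twice to ∇-twice)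
      open Nanophrase.Symmetric symmetric renaming (ι to ι↔; label to ι-label)

      N = nanoword 𝒜 (interleave value (inclusion ℬ⊆𝒜) xs vs) p
      open Kernel N

      ι : Letter ℬ → Letter ℬ
      ι = Inverse.to ι↔

      ι-injective : ∀ {A B} → ι A ≡ ι B → A ≡ B
      ι-injective = Injection.injective (↔⇒↣ ι↔)

      g : Letter ℬ → Letter 𝒜
      g = inclusion ℬ⊆𝒜

      g-injective : ∀ {A B} → g A ≡ g B → A ≡ B
      g-injective = Injection.injective (_⊆_.injection ℬ⊆𝒜)

      Together : Letter ℬ → Set
      Together B = component B 0F ≡ component B 1F

      -- `e B` is -1 to the power `ε B`, the sign by which `ι` changes the sign of `B`.
      e : Letter ℬ → ℤ
      e B = if does (component B 0F Fin.≟ component B 1F) then 1ℤ else -1ℤ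

      e-cases : ∀ B → (Together B × e B ≡ 1ℤ × ε B ≡ 0) ⊎ (¬ Together B × e B ≡ -1ℤ × ε B ≡ 1)
      e-cases B with component B 0F Fin.≟ component B 1F
      ... | yes eq = inj₁ (eq , refl , refl)
      ... | no neq = inj₂ (neq , refl , refl)

      e-unit : ∀ B → e B ≡ 1ℤ ⊎ e B ≡ -1ℤ
      e-unit B with e-cases B
      ... | inj₁ (_ , eq , _) = inj₁ eq
      ... | inj₂ (_ , eq , _) = inj₂ eq

      value≢g : ∀ (z : Letter (𝒜 ∖ Image ℬ⊆𝒜)) B → value z ≢ g B
      value≢g (z , Irrelevant.[ z∉ ]) B eq = contradiction-irr z∉ (λ z∉ → z∉ (B , sym eq))

      K-ι : ∀ A B → K (g (ι A)) (g (ι B)) ≡ K (g A) (g B)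
      K-ι A B = by (letter-≟ (twice N) (g A) (g B))
        where
        by : Dec (g A ≡ g B) → K (g (ι A)) (g (ι B)) ≡ K (g A) (g B)
        by (yes eq) = trans (K-≡ (cong (g ∘ ι) (g-injective eq))) (sym (K-≡ eq))
        by (no neq) = trans (K-≢ (neq ∘ cong g ∘ ι-injective ∘ g-injective)) (sym (K-≢ neq))

      K-e : ∀ A B → K (g A) (g B) * e B ≡ e A * K (g A) (g B)
      K-e A B = by (letter-≟ (twice N) (g A) (g B))
        where
        by : Dec (g A ≡ g B) → K (g A) (g B) * e B ≡ e A * K (g A) (g B)
        by (yes eq) = trans (cong (λ C → K (g A) (g B) * e C) (sym (g-injective eq)))
                            (ℤ.*-comm (K (g A) (g B)) (e A))
        by (no neq) = trans (cong (_* e B) (K-≢ neq))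
                            (sym (trans (cong (_*_ (e A)) (K-≢ neq)) (ℤ.*-zeroʳ (e A))))

      index-component : ∀ {B} (m : VecAny (B ∈_) vs) → VecAny.index m ≡ component B (Inverse.to (∇-twice B) m)
      index-component {B} m = cong VecAny.index (sym (Inverse.strictlyInverseʳ (∇-twice B) m))

      together : ∀ {B} → Together B → ∀ i → component B i ≡ component B 0F
      together eq 0F = refl
      together eq 1F = sym eq

      -- The two occurrences of `B` lie in different words, so one word holds at most one of them.
      apart⇒distinct : ∀ {B} → ¬ Together B → ∀ {r} (m n : B ∈ Vec.lookup vs r) → m ≡ n
      apart⇒distinct {B} apart {r} m n = at-injective vs r
        (Injection.injective (↔⇒↣ (∇-twice B)) (same _ _ (trans (at-r m) (sym (at-r n)))))
        where
        at-r : ∀ m → component B (Inverse.to (∇-twice B) (at vs r m)) ≡ r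
        at-r m = trans (sym (index-component (at vs r m))) (index-at vs r m)
        same : ∀ i j → component B i ≡ component B j → i ≡ j
        same i j eq with i Fin.≟ j
        same i  j  eq | yes i≡j = i≡j
        same 0F 0F eq | no i≢j = contradiction refl i≢j
        same 0F 1F eq | no _   = contradiction eq apart
        same 1F 0F eq | no _   = contradiction (sym eq) apart
        same 1F 1F eq | no i≢j = contradiction refl i≢j

      together⇒∉ : ∀ {B} → Together B → ∀ {r s} → B ∈ Vec.lookup vs r → B ∈ Vec.lookup vs s → r ≡ s
      together⇒∉ {B} eq {r} {s} m n = begin
        r                                                  ≡⟨ index-at vs r m ⟨
        VecAny.index (at vs r m)                           ≡⟨ index-component (at vs r m) ⟩
        component B (Inverse.to (∇-twice B) (at vs r m))   ≡⟨ together eq _ ⟩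
        component B 0F                                     ≡⟨ together eq _ ⟨
        component B (Inverse.to (∇-twice B) (at vs s n))   ≡⟨ index-component (at vs s n) ⟨
        VecAny.index (at vs s n)                           ≡⟨ index-at vs s n ⟩
        s                                                  ∎
        where open ≡-Reasoning

      -- For `e A` equal to 1 the invariance of the kernel under `ι` is enough. For -1, equal
      -- letters at different positions of one word are impossible, and for different letters both
      -- sides are 0.
      within : ∀ r → AllPairs (Compatible ι e (K on g) (K on g)) (Vec.lookup vs r)
      within r = allPairs-positions (Vec.lookup vs r) λ {A} {B} m n m≢n →
        compatible A B m n m≢n , trans (K-comm (ι B) (ι A)) (trans (compatible A B m n m≢n)
          (trans (sym (K-e A B)) (trans (ℤ.*-comm (K (g A) (g B)) (e B)) (cong (_*_ (e B)) (K-comm A B)))))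
        where
        K-comm : ∀ A B → K (g A) (g B) ≡ K (g B) (g A)
        K-comm A B = trans (sym (ℤ.*-identityˡ _)) (trans (K-weighted-sym (const 1ℤ) (g A) (g B)) (ℤ.*-identityˡ _))
        compatible : ∀ A B (m : A ∈ Vec.lookup vs r) (n : B ∈ Vec.lookup vs r) →
                     (∀ eq → subst (_∈ Vec.lookup vs r) eq m ≢ n) →
                     K (g (ι A)) (g (ι B)) ≡ e A * K (g A) (g B)
        compatible A B m n m≢n with letter-≟ (twice N) (g A) (g B) | e-cases A
        ... | no neq | _ = trans (K-ι A B)
          (trans (K-≢ neq) (sym (trans (cong (_*_ (e A)) (K-≢ neq)) (ℤ.*-zeroʳ (e A)))))
        ... | yes eq | inj₁ (_ , e≡1 , _) = trans (K-ι A B)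
          (sym (trans (cong (_* K (g A) (g B)) e≡1) (ℤ.*-identityˡ _)))
        ... | yes eq | inj₂ (apart , _) = contradiction (transported (g-injective eq)) (m≢n (g-injective eq))
          where
          transported : ∀ eq → subst (_∈ Vec.lookup vs r) eq m ≡ n
          transported refl = apart⇒distinct apart m n

      -- The letters of the other word are permuted by `ι`, so the sum is invariant. If both
      -- occurrences of `B` share a word the sum is 0; otherwise `e B` is -1 and the law `Anti` asks
      -- for invariance only.
      cross : ∀ {r s} → r ≢ s →
              All (Anti ι e (λ B → ∑ (K (g B) ∘ g) (Vec.lookup vs s))) (Vec.lookup vs r)
      cross {r} {s} r≢s = All.tabulate λ {B} m → ⟪ trans (invariant B) (by B m) ⟫
        where
        open ≡-Reasoning
        v = Vec.lookup vs s
        reversed : map ι v ≡ reverse v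
        reversed = lookup⁺ reverses s
        invariant : ∀ B → ∑ (K (g (ι B)) ∘ g) v ≡ ∑ (K (g B) ∘ g) v
        invariant B = begin
          ∑ (K (g (ι B)) ∘ g) v             ≡⟨ ∑-reverse (K (g (ι B)) ∘ g) v ⟨
          ∑ (K (g (ι B)) ∘ g) (reverse v)   ≡⟨ cong (∑ (K (g (ι B)) ∘ g)) reversed ⟨
          ∑ (K (g (ι B)) ∘ g) (map ι v)     ≡⟨ ∑-map (K (g (ι B)) ∘ g) ι v ⟩
          ∑ (K (g (ι B)) ∘ g ∘ ι) v         ≡⟨ ∑-cong (K-ι B) v ⟩
          ∑ (K (g B) ∘ g) v                 ∎
        by : ∀ B → B ∈ Vec.lookup vs r → ∑ (K (g B) ∘ g) v ≡ - (e B * ∑ (K (g B) ∘ g) v)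
        by B m with e-cases B
        ... | inj₁ (eq , _) = trans sum≡0
          (sym (trans (cong (λ n → - (e B * n)) sum≡0) (cong -_ (ℤ.*-zeroʳ (e B)))))
          where
          sum≡0 : ∑ (K (g B) ∘ g) v ≡ 0ℤ
          sum≡0 = ∑-zero-local (All.tabulate λ {C} n → K-≢ λ gB≡gC →
            r≢s (together⇒∉ eq m (subst (_∈ v) (sym (g-injective gB≡gC)) n)))
        ... | inj₂ (_ , e≡-1 , _) = sym (trans (cong (λ n → - (n * ∑ (K (g B) ∘ g) v)) e≡-1)
          (trans (cong -_ (ℤ.-1*i≡-i _)) (ℤ.neg-involutive _)))

      step : ∀ d → (u N d ≡ U (kernel N on value) (sgn N d ∘ value) (concat (Vec.toList xs)) → Q) → Q
      -- The label condition on `ι` yields the equation between signs only up to `Q`, so it is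
      -- assumed for the finitely many letters of the factor.
      step d use = all-or (concat (Vec.toList vs)) (λ B → sgn N d (g (ι B)) ℤ.≟ e B * sgn N d (g B)) refute
        λ same → use (U-interleave value g K (sgn N d) ι e e-unit
          (λ z B → K-≢ (value≢g z B)) (λ z B → K-≢ (value≢g z B ∘ sym)) K-ι K-e
          (λ B → same (∈-concat (Inverse.from (∇-twice B) 0F)))
          xs (allPairs-lookup⁻ vs (λ i j i≢j → cross i≢j , cross (i≢j ∘ sym)))
          (lookup⁻ within) reverses)
        where
        label : ∀ B → proj 𝒜 (g (ι B)) ≡ (τ ^ ε B) (proj 𝒜 (g B))
        label B = trans (_⊆_.label ℬ⊆𝒜 (ι B)) (trans (ι-label B)
          (cong (τ ^ ε B) (sym (_⊆_.label ℬ⊆𝒜 B))))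
        refute : ∀ B → sgn N d (g (ι B)) ≢ e B * sgn N d (g B) → Q
        refute B neq with e-cases B
        ... | inj₁ (_ , e≡1 , ε≡0) = sign-cong (d (g (ι B))) (d (g B))
          (trans (label B) (cong (λ n → (τ ^ n) (proj 𝒜 (g B))) ε≡0))
          (λ eq → neq (trans eq (sym (trans (cong (_* sgn N d (g B)) e≡1) (ℤ.*-identityˡ _)))))
        ... | inj₂ (_ , e≡-1 , ε≡1) = sign-τ (d (g B)) (d (g (ι B)))
          (trans (label B) (cong (λ n → (τ ^ n) (proj 𝒜 (g B))) ε≡1))
          (λ eq → neq (trans eq (sym (trans (cong (_* sgn N d (g B)) e≡-1) (ℤ.-1*i≡-i _)))))

    ≈-step : ∀ {N M} → N ↝ M → N ≈ M
    ≈-step (iso f)                                   = ≈-iso f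
    ≈-step (move₁ A x y)                             = ≈-move₁ A x y
    ≈-step (move₂ A B x y z eq)                      = ≈-move₂ A B x y z eq
    ≈-step (move₃ A B C x y z t A≢B A≢C B≢C eq eq′)  = ≈-move₃ A B C x y z t A≢B A≢C B≢C eq eq′
    ≈-step (surgery ∇ _ symmetric ℬ⊆𝒜 xs)            = ≈-surgery ∇ symmetric ℬ⊆𝒜 xs

    ~⇒≈ : ∀ {N M} → N ~ M → N ≈ M
    ~⇒≈ = Eq.fold ≈-isEquivalence ≈-step

    -- Additivity and vanishing on a generated subgroup

    u-∙ : ∀ N M d → u (N ∙ M) d ≡ u N (d ∘ inj₁) + u M (d ∘ inj₂)
    u-∙ N M d = begin
      ∑ h (map inj₁ (word N) ++ map inj₂ (word M))
        ≡⟨ trans (∑-++ h (map inj₁ (word N)) _) (cong₂ _+_ (∑-map h inj₁ (word N)) (∑-map h inj₂ (word M))) ⟩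
      ∑ (h ∘ inj₁) (word N) + ∑ (h ∘ inj₂) (word M)
        ≡⟨ cong₂ _+_
             (∑-cong (λ A → cong (λ n → σ (inj₁ A) * φ n) (index-disjointˡ inj₁ inj₂ K σ
               disjointˡ disjointʳ sym-K (word N) (word M) A)) (word N))
             (∑-cong (λ A → cong (λ n → σ (inj₂ A) * φ n) (index-disjointʳ inj₁ inj₂ K σ
               disjointˡ disjointʳ sym-K (word N) (word M) A)) (word M)) ⟩
      U (K on inj₁) (σ ∘ inj₁) (word N) + U (K on inj₂) (σ ∘ inj₂) (word M)
        ≡⟨ cong₂ _+_
             (U-cong {σ = σ ∘ inj₁} (kernel-injective {N ∙ M} {N} inj₁-injective) (λ _ → refl) (word N))
             (U-cong {σ = σ ∘ inj₂} (kernel-injective {N ∙ M} {M} inj₂-injective) (λ _ → refl) (word M)) ⟩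
      u N (d ∘ inj₁) + u M (d ∘ inj₂) ∎
      where
      open ≡-Reasoning
      open Kernel (N ∙ M)
      σ = sgn (N ∙ M) d
      h = contribution K σ (word (N ∙ M))
      disjointˡ : ∀ A B → K (inj₁ A) (inj₂ B) ≡ 0ℤ
      disjointˡ A B = K-≢ {inj₁ A} {inj₂ B} λ ()
      disjointʳ : ∀ A B → K (inj₂ B) (inj₁ A) ≡ 0ℤ
      disjointʳ A B = K-≢ {inj₂ B} {inj₁ A} λ ()
      sym-K = K-weighted-sym σ

    record Vanishes (N : Nanoword) : Set a where
      constructor vanishing
      field
        apply : ∀ d → u N d ≢ 0ℤ → Q

    vanishes-∙ : ∀ {N M} → Vanishes N → Vanishes M → Vanishes (N ∙ M)
    vanishes-∙ {N} {M} (vanishing vN) (vanishing vM) = vanishing by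
      where
      by : ∀ d → u (N ∙ M) d ≢ 0ℤ → Q
      by d neq with u N (d ∘ inj₁) ℤ.≟ 0ℤ | u M (d ∘ inj₂) ℤ.≟ 0ℤ
      ... | no N≢0 | _      = vN (d ∘ inj₁) N≢0
      ... | yes _  | no M≢0 = vM (d ∘ inj₂) M≢0
      ... | yes p  | yes q  = contradiction (trans (u-∙ N M d) (cong₂ _+_ p q)) neq

    vanishes-≈ : ∀ {N M} → N ≈ M → Vanishes N → Vanishes M
    vanishes-≈ {N} {M} ⟦ N≈M ⟧ (vanishing vN) = vanishing λ d neq → decorate N (by d neq)
      where
      by : ∀ d → u M d ≢ 0ℤ → Decoration N → Q
      by d neq d′ with u N d′ ℤ.≟ 0ℤ
      ... | no N≢0  = vN d′ N≢0
      ... | yes N≡0 = N≈M d′ d (λ eq → neq (trans (sym eq) N≡0))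

    vanishes-∅ : Vanishes ∅
    vanishes-∅ = vanishing λ d neq → contradiction refl neq

    -- By additivity applied to `N ∙ N ⁻`, which is cobordant to the empty nanoword. Both factors
    -- have the same alphabet, so `d` decorates each of them.
    vanishes-⁻ : ∀ {N} → Vanishes N → Vanishes (N ⁻)
    vanishes-⁻ {N} vN = vanishing by
      where
      N∙N⁻ : Vanishes (N ∙ N ⁻)
      N∙N⁻ = vanishes-≈ (≈-sym (~⇒≈ (Group.inverseʳ 𝒩c N))) vanishes-∅
      by : ∀ d → u (N ⁻) d ≢ 0ℤ → Q
      by d neq with u N d ℤ.≟ 0ℤ
      ... | no N≢0  = Vanishes.apply vN d N≢0
      ... | yes N≡0 = Vanishes.apply N∙N⁻ [ d , d ] λ eq → neq
        (trans (sym (trans (u-∙ N (N ⁻) [ d , d ]) (trans (cong (_+ u (N ⁻) d) N≡0) (ℤ.+-identityˡ _)))) eq)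

    generated-vanishes : ∀ {gs} → All Vanishes gs → ∀ {N} → Generated 𝒩c gs N → Vanishes N
    generated-vanishes vs (generator N∈gs) = All.lookupWith
      (λ v N~g → vanishes-≈ (≈-sym (~⇒≈ N~g)) v) vs N∈gs
    generated-vanishes vs unit           = vanishes-∅
    generated-vanishes vs (product p q)  = vanishes-∙ (generated-vanishes vs p) (generated-vanishes vs q)
    generated-vanishes vs (inverse p)    = vanishes-⁻ (generated-vanishes vs p)
    generated-vanishes vs (respects e p) = vanishes-≈ (~⇒≈ e) (generated-vanishes vs p)

-- Separating nested words from finitely many nanowords

select : ℕ → ℤ → ℤ
select m n = if does (∣ n ∣ ℕ.≟ m) then n else 0ℤ

select-≡ : ∀ {m n} → ∣ n ∣ ≡ m → select m n ≡ n
select-≡ {m} {n} eq = cong (λ b → if b then n else 0ℤ) (dec-true (∣ n ∣ ℕ.≟ m) eq)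

select-≢ : ∀ {m n} → ∣ n ∣ ≢ m → select m n ≡ 0ℤ
select-≢ {m} {n} neq = cong (λ b → if b then n else 0ℤ) (dec-false (∣ n ∣ ℕ.≟ m) neq)

select-odd : ∀ m n → select m (- n) ≡ - select m n
select-odd m n = by (∣ n ∣ ℕ.≟ m)
  where
  by : Dec (∣ n ∣ ≡ m) → select m (- n) ≡ - select m n
  by (yes eq) = trans (select-≡ {n = - n} (trans (ℤ.∣-i∣≡∣i∣ n) eq)) (cong -_ (sym (select-≡ {n = n} eq)))
  by (no neq) = trans (select-≢ {n = - n} (neq ∘ trans (sym (ℤ.∣-i∣≡∣i∣ n)))) (cong -_ (sym (select-≢ {n = n} neq)))

eventually-≢ : (ℓ : X → ℕ) (w : List X) → ∃ λ M → ∀ {m} → M ≤ m → All (λ A → ℓ A ≢ m) w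
eventually-≢ ℓ []      = 0 , λ _ → []
eventually-≢ ℓ (A ∷ w) with M , later ← eventually-≢ ℓ w = suc (ℓ A) ⊔ M , λ le →
  ℕ.<⇒≢ (ℕ.m⊔n≤o⇒m≤o (suc (ℓ A)) M le) ∷ later (ℕ.m⊔n≤o⇒n≤o (suc (ℓ A)) M le)

unique-∈↔Fin1 : {w : List X} {A : X} → Unique w → A ∈ w → (A ∈ w) ↔ Fin 1
unique-∈↔Fin1 unique A∈w = mk↔ₛ′ (const 0F) (const A∈w) (λ { 0F → refl ; (suc ()) })
  (λ _ → unique⇒irrelevant unique _ _)

-- Abstract, since unfolding the letter positions of the concrete nanowords makes
-- conversion checking run out of memory.
abstract
  nest-eachTwice : ∀ k → EachTwice (nest zero suc (allFin k))
  nest-eachTwice k B = ↔-trans (↔-sym ++↔)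
    (↔-trans (once ⊎-cong ↔-trans (↭⇒∼bag (prep zero (↭-reverse (map suc (allFin k))))) once) (↔-sym Fin.+↔⊎))
    where
    unique : Unique (zero ∷ map suc (allFin k))
    unique = All.map⁺ (All.universal (λ _ ()) (allFin k)) ∷ map⁺ Fin.suc-injective (allFin⁺ k)
    member : ∀ B → B ∈ zero ∷ map suc (allFin k)
    member zero    = here refl
    member (suc i) = there (∈-map⁺ suc (∈-allFin i))
    once : (B ∈ zero ∷ map suc (allFin k)) ↔ Fin 1
    once = unique-∈↔Fin1 unique (member B)

module _ {a} {α : Set a} (τ : α → α) (τ-involutive : Involutive _≡_ τ) (x₀ : α) where

  open Nanowords τ
  open Cobordism τ τ-involutive x₀
  module Selecting m = Obstruction (select m) (select-odd m)
  open Selecting using (Vanishes; vanishing; ⟦_⟧; _≈_; u)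

  nested : ℕ → Nanoword
  nested k = nanoword (record { Letter = Fin (suc k) ; proj = const x₀ })
                      (nest zero suc (allFin k)) (nest-eachTwice k)

  -- Only the outer letter has index of absolute value `m`: the inner letters have index 2, and `m`
  -- is at least 4. Its two occurrences contribute `- + m` each.
  u-nested : ∀ n → 2 ≤ n → u (2 ℕ.* n) (nested n) (λ _ → plus refl) ≢ 0ℤ
  u-nested n 2≤n u≡0 = ℕ.<⇒≢ (ℕ.<-≤-trans (s≤s z≤n) 4≤m)
    (sym (trans (sym (ℤ.∣-i∣≡∣i∣ (+ m))) (cong ∣_∣ (x≡-x⇒x≡0 (- + m) (begin
      - + m                                       ≡⟨ lemma (- + m) ⟩
      - + m + (0ℤ + (- + m + 0ℤ)) + - (- + m)     ≡⟨ cong (_+ - (- + m)) (trans (sym total) u≡0) ⟩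
      0ℤ + - (- + m)                              ≡⟨ ℤ.+-identityˡ (- (- + m)) ⟩
      - (- + m)                                   ∎)))))
    where
    open ≡-Reasoning
    m = 2 ℕ.* n
    S = map suc (allFin n)
    w = nest zero suc (allFin n)
    open Kernel (nested n)
    open Invariant (select m) (select-odd m)

    4≤m : 4 ≤ m
    4≤m = ℕ.*-monoʳ-≤ 2 2≤n

    lemma : ∀ a → a ≡ a + (0ℤ + (a + 0ℤ)) + - a
    lemma = solve-∀

    once : ∀ i → ∑ (K (suc i) ∘ suc) (allFin n) ≡ 1ℤ
    once i = trans (sym (∑-map (K (suc i)) suc (allFin n)))
      (∑-∈↔Fin (unique-∈↔Fin1 (map⁺ Fin.suc-injective (allFin⁺ n)) (∈-map⁺ suc (∈-allFin i))))

    index≡ : ∀ e → index K (const 1ℤ) w e ≡ + 2 * ∑ (K e) S - + 2 * + length (allFin n) * K e zero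
    index≡ = index-nest K zero suc (allFin n)
      (K-≡ {zero} refl) (λ i → K-≢ {zero} {suc i} λ ()) (λ i → K-≢ {suc i} {zero} λ ()) once
      (AllPairs.map (λ {i} {j} i≢j → K-≢ {suc i} {suc j} (i≢j ∘ Fin.suc-injective) ,
                                     K-≢ {suc j} {suc i} (i≢j ∘ sym ∘ Fin.suc-injective)) (allFin⁺ n))

    index-zero : index K (const 1ℤ) w zero ≡ - + m
    index-zero = trans (index≡ zero) (trans
      (cong₂ (λ a b → + 2 * a - + 2 * + length (allFin n) * b)
        (trans (∑-map (K zero) suc (allFin n)) (∑-zero (λ i → K-≢ {zero} {suc i} λ ()) (allFin n)))
        (K-≡ {zero} refl))
      (trans (ℤ.+-identityˡ (- (+ 2 * + length (allFin n) * 1ℤ)))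
        (cong -_ (trans (ℤ.*-identityʳ (+ 2 * + length (allFin n)))
          (trans (sym (ℤ.pos-* 2 (length (allFin n)))) (cong (λ l → + (2 ℕ.* l)) (length-tabulate {n = n} id)))))))

    index-suc : ∀ i → index K (const 1ℤ) w (suc i) ≡ + 2
    index-suc i = trans (index≡ (suc i)) (trans
      (cong₂ (λ a b → + 2 * a - + 2 * + length (allFin n) * b)
        (trans (∑-map (K (suc i)) suc (allFin n)) (once i)) (K-≢ {suc i} {zero} λ ()))
      (cong (_-_ (+ 2)) (ℤ.*-zeroʳ (+ 2 * + length (allFin n)))))

    h = contribution K (const 1ℤ) w

    h-zero : h zero ≡ - + m
    h-zero = trans (ℤ.*-identityˡ (select m (index K (const 1ℤ) w zero)))
      (trans (cong (select m) index-zero) (select-≡ {n = - + m} (ℤ.∣-i∣≡∣i∣ (+ m))))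

    h-suc : ∀ i → h (suc i) ≡ 0ℤ
    h-suc i = trans (ℤ.*-identityˡ (select m (index K (const 1ℤ) w (suc i))))
      (trans (cong (select m) (index-suc i)) (select-≢ {m} {+ 2} (ℕ.<⇒≢ (ℕ.<-≤-trans (s≤s (s≤s (s≤s z≤n))) 4≤m))))

    h-S : ∑ h S ≡ 0ℤ
    h-S = trans (∑-map h suc (allFin n)) (∑-zero h-suc (allFin n))

    total : u m (nested n) (λ _ → plus refl) ≡ - + m + (0ℤ + (- + m + 0ℤ))
    total = cong₂ _+_ h-zero (trans (∑-++ h S (zero ∷ reverse S))
      (cong₂ _+_ h-S (cong₂ _+_ h-zero (trans (∑-reverse h S) h-S))))

  eventually-vanishes : ∀ N → Decoration N → ∃ λ M → ∀ {m} → M ≤ m → Vanishes m N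
  eventually-vanishes N d = by (eventually-≢ (λ A → ∣ i A ∣) (Nanoword.word N))
    where
    i = index (kernel N) (sgn N d) (Nanoword.word N)
    by : (∃ λ M → ∀ {m} → M ≤ m → All (λ A → ∣ i A ∣ ≢ m) (Nanoword.word N)) →
         ∃ λ M → ∀ {m} → M ≤ m → Vanishes m N
    by (M , later) = M , λ {m} M≤m → vanishing λ d′ neq →
      -- The bound comes from the decoration `d`; any other decoration gives the same value up to
      -- `Q`, by reflexivity of `_≈_`.
      _≈_.apply (Selecting.≈-refl m {N}) d′ d λ eq → neq (trans eq (∑-zero-local
        (All.map (λ {A} ≢m → trans (cong (_*_ (sgn N d A)) (select-≢ {m} {i A} ≢m)) (ℤ.*-zeroʳ (sgn N d A)))
                 (later M≤m))))

  decorate-all : ∀ gs → (All Decoration gs → Q) → Q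
  decorate-all []       use = use []
  decorate-all (N ∷ gs) use = decorate N λ d → decorate-all gs λ ds → use (d ∷ ds)

  all-eventually-vanish : ∀ {gs} → All Decoration gs → ∃ λ M → ∀ {m} → M ≤ m → All (Vanishes m) gs
  all-eventually-vanish []       = 0 , λ _ → []
  all-eventually-vanish (d ∷ ds)
    with M , later ← eventually-vanishes _ d | M′ , later′ ← all-eventually-vanish ds =
    M ⊔ M′ , λ le → later (ℕ.m⊔n≤o⇒m≤o M M′ le) ∷ later′ (ℕ.m⊔n≤o⇒n≤o M M′ le)

  finitelyGenerated⇒fixed : FinitelyGenerated 𝒩c → τ x₀ ≡ x₀
  finitelyGenerated⇒fixed (gs , generated) = decorate-all gs λ ds → by (all-eventually-vanish ds)
    where
    by : (∃ λ M → ∀ {m} → M ≤ m → All (Vanishes m) gs) → τ x₀ ≡ x₀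
    -- For n = M + 2 the number m = 2n is at least M, so the generators vanish, and n is at least 2,
    -- as `u-nested` requires.
    by (M , later) = Vanishes.apply
      (Selecting.generated-vanishes _
        (later (ℕ.≤-trans (ℕ.≤-trans (ℕ.n≤1+n M) (ℕ.n≤1+n _)) (ℕ.m≤m+n (suc (suc M)) _)))
        (generated (nested (suc (suc M)))))
      (λ _ → plus refl) (u-nested (suc (suc M)) (s≤s (s≤s z≤n)))

theorem8p1p1 : ∀ {a} {α : Set a} (τ : α → α) → Involutive _≡_ τ →
    ¬ (τ ≗ id) → ¬ FinitelyGenerated (Nanowords.𝒩c τ)
theorem8p1p1 τ τ-involutive τ≢id generated =
  τ≢id λ x → finitelyGenerated⇒fixed τ τ-involutive x generated
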